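{- Let $A=\mathbb{F}_q[t]$ and let $f_1,\ldots,f_r,g\in A$ be non-constant. Let $f$ be a polynomial function from $A/f_1A\times\cdots\times A/f_rA$ to $A/gA$. Then $f$ is represented by exactly one polynomial of the form $$F=\sum_{\mathbf{k}}b_{\mathbf{k}}(\mathbf{x})_{\mathbf{k}},$$ where the sum is over all $\mathbf{k}=(k_1,\ldots,k_r)\in\mathbb{N}^r$ with $0\le k_i<\mu(f_i,g)$ for each $i$, and the coefficients $b_{\mathbf{k}}\in A$ satisfy $b_{\mathbf{k}}=0$ or $$\deg b_{\mathbf{k}}<\deg\frac{g}{\gcd\!\Big(g,\prod_{i=1}^r\prod_{j=0}^{k_i-1}(a_{k_i}-a_j)\Big)}.$$
   Context: Write $\mathbb{F}_q=\{a_0=0,a_1,\ldots,a_{q-1}\}$. For $k\in\mathbb{N}$ with base-$q$ expansion $k=c_0+c_1q+\cdots+c_hq^h$ ($0\le c_s<q$), define $a_k=a_{c_0}+a_{c_1}t+\cdots+a_{c_h}t^h\in A$. Thus $\{a_0,\ldots,a_{q^d-1}\}$ is the set of polynomials of degree $<d$. For each $i$, $A/f_iA$ is identified with the complete residue system $\{a_0,\ldots,a_{q^{\deg f_i}-1}\}$ (polynomials of degree $<\deg f_i$). A function $f$ from $A/f_1A\times\cdots\times A/f_rA$ to $A/gA$ is a polynomial function (and $F\in A[x_1,\ldots,x_r]$ represents it) if $F(b_1,\ldots,b_r)\equiv f(b_1,\ldots,b_r)\pmod g$ for all $(b_1,\ldots,b_r)$ with $\deg b_i<\deg f_i$ (i.e.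 $b_i\in\{a_0,\ldots,a_{q^{\deg f_i}-1}\}$) for each $i$. For $\mathbf{k}\in\mathbb{N}^r$, $(\mathbf{x})_{\mathbf{k}}=\prod_{i=1}^r(x_i-a_0)(x_i-a_1)\cdots(x_i-a_{k_i-1})$ (empty product $=1$). $\lambda(g)$ is the smallest positive integer $k$ such that $g\mid\prod_{j=0}^{k-1}(a_k-a_j)$, and $\mu(f_i,g)=\min(q^{\deg f_i},\lambda(g))$. -}

module Defs where

open import Algebra.Apartness.Bundles using (HeytingField)
open import Algebra.Bundles using (CommutativeRing; RawRing)
import Algebra.Definitions.RawMagma as Divisibility
import Algebra.Definitions.RawMonoid as RawMonoidOps
open import Data.Bool.Base using (if_then_else_)
open import Data.Digit using (toDigits)
open import Data.Fin.Base using (Fin; zero; suc; toℕ)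
import Data.Fin.Properties as Fin using (_≟_)
open import Data.List.Base using (List; []; _∷_; foldr; map; upTo; cartesianProductWith)
open import Data.List.Relation.Unary.All using (all?)
open import Data.Nat.Base as ℕ using (ℕ; zero; suc; _<_; _≤_; _⊓_; z≤n; s≤s)
open import Data.Product.Base using (Σ; ∃; ∃-syntax; _×_; _,_; proj₁)
open import Data.Sum.Base using (_⊎_)
open import Data.Vec.Base as Vec using (Vec; []; _∷_; lookup)
open import Data.Vec.Relation.Binary.Pointwise.Inductive using (Pointwise)
open import Function.Bundles using (Inverse)
import Function.Construct.Symmetry as Symmetry
open import Function.Properties.Inverse using (Inverse⇒Injection)
open import Level using (_⊔_) renaming (suc to lsuc)
open import Relation.Binary.Definitions using (Decidable)
import Relation.Binary.PropositionalEquality as ≡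
open ≡ using (_≡_; _≢_)
open import Relation.Nullary.Decidable using (does; fromWitness; via-injection)
open import Relation.Nullary.Negation using (contradiction)

------------------------------------------------------------------------
-- Polynomials over a raw ring

-- A polynomial is a list of coefficients, lowest degree first. Trailing
-- zeros are allowed, so equality compares all coefficients.

module Polynomial {c ℓ} (R : RawRing c ℓ) where
  open RawRing R

  coeff : List Carrier → ℕ → Carrier
  coeff []      _       = 0#
  coeff (x ∷ _) zero    = x
  coeff (_ ∷ p) (suc n) = coeff p n

  add : List Carrier → List Carrier → List Carrier
  add []      q       = q
  add (x ∷ p) []      = x ∷ p
  add (x ∷ p) (y ∷ q) = (x + y) ∷ add p q

  mul : List Carrier → List Carrier → List Carrier
  mul []      q = []
  mul (x ∷ p) q = add (map (x *_) q) (0# ∷ mul p q)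

  polynomialRing : RawRing c ℓ
  polynomialRing = record
    { Carrier = List Carrier
    ; _≈_     = λ p q → ∀ n → coeff p n ≈ coeff q n
    ; _+_     = add
    ; _*_     = mul
    ; -_      = map (-_)
    ; 0#      = []
    ; 1#      = 1# ∷ []
    }

open Polynomial public using (polynomialRing)

-- R[x₁,…,xᵣ], built as (R[x₂,…,xᵣ])[x₁].

multivariateRing : ∀ {c ℓ} → RawRing c ℓ → ℕ → RawRing c ℓ
multivariateRing R zero    = R
multivariateRing R (suc r) = polynomialRing (multivariateRing R r)

module Multivariate {c ℓ} (R : RawRing c ℓ) where
  open RawRing R

  MPoly : ℕ → Set c
  MPoly r = RawRing.Carrier (multivariateRing R r)

  const : ∀ {r} → Carrier → MPoly r
  const {zero}  x = x
  const {suc r} x = const {r} x ∷ []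

  var : ∀ {r} → Fin r → MPoly r
  var {suc r} zero    = RawRing.0# (multivariateRing R r) ∷ RawRing.1# (multivariateRing R r) ∷ []
  var {suc r} (suc i) = var i ∷ []

  eval : ∀ {r} → MPoly r → Vec Carrier r → Carrier
  eval F []       = F
  eval F (b ∷ bs) = foldr (λ G rest → eval G bs + b * rest) 0# F

-- Although R carries no laws, the module is only applied to polynomial
-- rings over a finite field.

module RawRingOps {c ℓ} (R : RawRing c ℓ) where
  open RawRing R

  infixl 6 _-_
  _-_ : Carrier → Carrier → Carrier
  x - y = x + (- y)

  open Divisibility *-rawMagma public using (_∣_)
  open RawMonoidOps *-rawMonoid public using () renaming (sum to product)

  infix 4 _≡_[mod_]
  _≡_[mod_] : Carrier → Carrier → Carrier → Set (c ⊔ ℓ)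
  x ≡ y [mod m ] = m ∣ (x - y)

  record IsGCD (d x y : Carrier) : Set (c ⊔ ℓ) where
    field
      divides-left  : d ∣ x
      divides-right : d ∣ y
      greatest      : ∀ {e} → e ∣ x → e ∣ y → e ∣ d

  sumOver : ∀ {i} {I : Set i} → List I → (I → Carrier) → Carrier
  sumOver is h = foldr _+_ 0# (map h is)

-- All k with kᵢ < mᵢ for each i.

multiIndices : ∀ {r} → Vec ℕ r → List (Vec ℕ r)
multiIndices []       = [] ∷ []
multiIndices (m ∷ ms) = cartesianProductWith _∷_ (upTo m) (multiIndices ms)

------------------------------------------------------------------------
-- Finite fields with an enumeration a₀ = 0, a₁, …, a_{q-1}

private
  distinct⇒1<n : ∀ {n} {i j : Fin n} → i ≢ j → 1 < n
  distinct⇒1<n {suc zero} {zero} {zero} i≢j = contradiction ≡.refl i≢j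
  distinct⇒1<n {suc (suc n)} _ = s≤s (s≤s z≤n)

-- Over a finite carrier the apartness of a Heyting field is just
-- inequality, so this is the usual notion of field.

record FiniteField c ℓ₁ ℓ₂ : Set (lsuc (c ⊔ ℓ₁ ⊔ ℓ₂)) where
  field
    heytingField : HeytingField c ℓ₁ ℓ₂

  open HeytingField heytingField public

  commutativeRing : CommutativeRing c ℓ₁
  commutativeRing = record { isCommutativeRing = isCommutativeRing }

  open CommutativeRing commutativeRing public using (rawRing)

  field
    q                : ℕ
    enumeration      : Inverse (≡.setoid (Fin q)) setoid
    enumeration-zero : ∀ i → toℕ i ≡ 0 → Inverse.to enumeration i ≈ 0#

  _≈?_ : Decidable _≈_
  _≈?_ = via-injection (Inverse⇒Injection (Symmetry.inverse enumeration)) Fin._≟_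

  1<q : 1 < q
  1<q = distinct⇒1<n {i = from 1#} {j = from 0#} λ eq →
    #-irrefl (trans (sym (inverseˡ ≡.refl)) (inverseˡ eq)) 1#0
    where
    open Inverse enumeration using (from; inverseˡ)
    open import Relation.Binary.Reasoning.Setoid setoid

    1*[1-0]≈1 : 1# * (1# - 0#) ≈ 1#
    1*[1-0]≈1 = begin
      1# * (1# - 0#)     ≈⟨ *-identityˡ _ ⟩
      1# - 0#            ≈⟨ +-identityʳ _ ⟨
      1# - 0# + 0#       ≈⟨ +-assoc _ _ _ ⟩
      1# + ((- 0#) + 0#) ≈⟨ +-congˡ (-‿inverseˡ _) ⟩
      1# + 0#            ≈⟨ +-identityʳ _ ⟩
      1#                 ∎

    1#0 : 1# # 0#
    1#0 = invertible⇒# (1# , 1*[1-0]≈1 , trans (*-comm _ _) 1*[1-0]≈1)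

module OverFiniteField {c ℓ₁ ℓ₂} (𝔽 : FiniteField c ℓ₁ ℓ₂) where
  module 𝔽 = FiniteField 𝔽

  A : RawRing c ℓ₁
  A = polynomialRing 𝔽.rawRing

  open RawRing A public using () renaming (Carrier to ∣A∣; _≈_ to _≈ᴬ_)
  open RawRing A using (_*_; 0#)
  open RawRingOps A using (_-_; _∣_; product; _≡_[mod_]; IsGCD)

  -- The zero polynomial gets degree 0 here; wherever it matters, zero is
  -- treated separately (see _deg<_).
  deg : ∣A∣ → ℕ
  deg []      = 0
  deg (_ ∷ p) = if does (all? (𝔽._≈? 𝔽.0#) p) then 0 else suc (deg p)

  NonConstant : ∣A∣ → Set
  NonConstant p = 0 < deg p

  infix 4 _deg<_
  _deg<_ : ∣A∣ → ℕ → Set ℓ₁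
  p deg< n = p ≈ᴬ 0# ⊎ deg p < n

  -- The polynomial a_k = a_{c₀} + a_{c₁} t + ⋯, where c₀, c₁, … are the
  -- base-q digits of k, least significant first.
  a : ℕ → ∣A∣
  a k = map (Inverse.to 𝔽.enumeration)
            (proj₁ (toDigits 𝔽.q {fromWitness 𝔽.1<q} k))

  -- ∏_{j<k} (a_k - a_j)
  factorial : ℕ → ∣A∣
  factorial k = product {k} λ j → a k - a (toℕ j)

  record IsLambda (g : ∣A∣) (l : ℕ) : Set (c ⊔ ℓ₁) where
    field
      positive : 0 < l
      divides  : g ∣ factorial l
      least    : ∀ {k} → 0 < k → g ∣ factorial k → l ≤ k

  -- The residue system of A/f₁A × ⋯ × A/fᵣA.
  Residues : ∀ {r} → Vec ∣A∣ r → Set (c ⊔ ℓ₁)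
  Residues {r} fs = Σ (Vec ∣A∣ r) λ bs → Pointwise (λ b f → b deg< deg f) bs fs

  open Multivariate A public using (MPoly)
  open Multivariate A using (const; var; eval)

  module _ {r : ℕ} where
    module A[x] where
      open RawRing (multivariateRing A r) public
      open RawRingOps (multivariateRing A r) public

    infix 4 _≈ᴹ_
    _≈ᴹ_ : MPoly r → MPoly r → Set ℓ₁
    _≈ᴹ_ = A[x]._≈_

    -- Values in A/gA are given by representatives in A. No compatibility
    -- of φ with ≈ᴬ is demanded: modulo g, it holds for every φ that is
    -- represented by a polynomial.
    Represents : (fs : Vec ∣A∣ r) (g : ∣A∣) → MPoly r → (Residues fs → ∣A∣) → Set (c ⊔ ℓ₁)
    Represents fs g F φ = ∀ (bs : Residues fs) → eval F (proj₁ bs) ≡ φ bs [mod g ]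

    IsPolynomialFunction : (fs : Vec ∣A∣ r) (g : ∣A∣) → (Residues fs → ∣A∣) → Set (c ⊔ ℓ₁)
    IsPolynomialFunction fs g φ = ∃ λ (F : MPoly r) → Represents fs g F φ

    -- (x)_k = ∏ᵢ ∏_{j<kᵢ} (xᵢ - a_j)
    fallingFactorial : Vec ℕ r → MPoly r
    fallingFactorial ks =
      A[x].product λ i → A[x].product {lookup ks i} λ j → var i A[x].- const {r} (a (toℕ j))

    multiFactorial : Vec ℕ r → ∣A∣
    multiFactorial ks = product λ i → factorial (lookup ks i)

    -- b = 0 or deg b < deg (g / gcd (g , ∏ᵢ ∏_{j<kᵢ} (a_{kᵢ} - a_j))). A gcd d
    -- is determined up to a unit and h is the quotient g / d, so the degree
    -- does not depend on the choice of d.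
    CoefficientBound : ∣A∣ → Vec ℕ r → ∣A∣ → Set (c ⊔ ℓ₁)
    CoefficientBound g ks b =
      ∃[ d ] ∃[ h ] IsGCD d g (multiFactorial ks) × (h * d) ≈ᴬ g × b deg< deg h

    μ : ℕ → ∣A∣ → ℕ
    μ l f = (𝔽.q ℕ.^ deg f) ⊓ l

    -- The field `lam` is λ(g), which IsLambda determines uniquely. Values of
    -- `b` at indices outside the box kᵢ < μ(fᵢ, g) play no role.
    record NormalForm (fs : Vec ∣A∣ r) (g : ∣A∣) (F : MPoly r) : Set (c ⊔ ℓ₁) where
      field
        lam      : ℕ
        isLambda : IsLambda g lam
        b        : Vec ℕ r → ∣A∣
        bounded  : ∀ ks → Pointwise _<_ ks (Vec.map (μ lam) fs) → CoefficientBound g ks (b ks)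
        expand   : F ≈ᴹ A[x].sumOver (multiIndices (Vec.map (μ lam) fs))
                          (λ ks → const {r} (b ks) A[x].* fallingFactorial ks)

{-# OPTIONS --safe #-}

-- Write (x)ₖ = (x - a₀)⋯(x - aₖ₋₁) and k! = (aₖ)ₖ. Everything rests on
-- Carlitz's theorem that k! divides (x)ₖ for every x ∈ A. With
-- e_h(x) = ∏_{deg m < h} (x - m), expanding k in base q turns (x)ₖ into a
-- product of factors e_h(x) - a_i D_h, where D_h = e_h(t^h), so it is enough
-- that D_h divides e_h(x). The quotient E_h satisfies
-- E_h(t x) = t E_h(x) + E_{h-1}(x)^q, so its values lie in A by induction on
-- the degree of x.
--
-- Existence: Horner's rule rewrites any polynomial in the Newton basis modulo
-- g, because (x)_μ vanishes modulo g at every residue. Reducing the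
-- coefficient at k modulo g / gcd(g, k!) leaves the values unchanged modulo g,
-- as k! divides (x)ₖ. Uniqueness: at the point (a_{k₁}, …, a_{kᵣ}) the Newton
-- basis is triangular with diagonal entry k!, so the difference b of the two
-- coefficients at k satisfies g ∣ b k!, and its degree forces b = 0.
module Submission where

open import Algebra.Bundles using (CommutativeRing; RawRing)
import Algebra.Morphism.Construct.Identity as IdentityMorphism
open import Algebra.Morphism.Structures using (module RingMorphisms)
import Algebra.Properties.CommutativeMonoid.Sum as CommutativeMonoidSum
import Algebra.Properties.CommutativeSemigroup as CommutativeSemigroupProperties
import Algebra.Properties.CommutativeSemiring.Exp as Exp
import Algebra.Properties.Ring as RingProperties
import Algebra.Properties.Semiring.Mult as Mult
import Algebra.Solver.Ring as RingSolver
import Algebra.Solver.Ring.AlmostCommutativeRing as ACR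
open import Algebra.Structures using (IsCommutativeRing)
open import Data.Digit using (toDigits; fromDigits)
open import Data.Fin.Base as Fin using (Fin; zero; suc; toℕ)
open import Data.Fin.Permutation using (Permutation; permutation; _⟨$⟩ʳ_)
import Data.Fin.Properties as Fin
open import Data.Integer.Base as ℤ using (ℤ; +_; -[1+_]; 0ℤ)
import Data.Integer.Properties as ℤ
open import Data.List.Base as List using (List; []; _∷_; map; foldr; _++_; applyUpTo)
import Data.List.Properties as List
import Data.List.Relation.Unary.All as ListAll
open import Data.Maybe.Base using (Maybe; just; nothing)
open import Data.Nat.Base as ℕ
  using (ℕ; zero; suc; _<_; _≤_; z≤n; s≤s; NonZero; _/_; _%_; _⊓_)
import Data.Nat.DivMod as ℕ
open import Data.Nat.Induction using (<-rec)
import Data.Nat.Properties as ℕ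
open import Data.Nat.Tactic.RingSolver using (solve-∀)
open import Data.Product using (∃!; _×_)
open import Data.Product.Base using (_,_; ∃; ∃₂; proj₁; proj₂)
open import Data.Sum.Base using (_⊎_; inj₁; inj₂)
open import Data.Vec.Base as Vec using (Vec; []; _∷_; lookup)
open import Data.Vec.Relation.Binary.Pointwise.Inductive as Pointwise using (Pointwise; []; _∷_)
open import Data.Vec.Relation.Unary.All using (All; []; _∷_)
open import Function.Base using (_∘_; id)
open import Function.Bundles using (Inverse)
open import Level using (_⊔_)
open import Relation.Binary.Definitions using (tri<; tri≈; tri>)
open import Relation.Binary.PropositionalEquality as ≡ using (_≡_; _≢_)
import Relation.Binary.Reasoning.Setoid as SetoidReasoning
open import Relation.Nullary.Decidable using (Dec; yes; no; fromWitness; _×-dec_)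
open import Relation.Nullary.Negation using (¬_; contradiction)
open import Relation.Unary using (Pred; Decidable)
open import Defs

-- The recursion for E_h needs x ↦ x^q to be additive. Fermat's theorem in F_q gives X^q - X = ∏ (X
-- - c) over the constants c; this product is invariant under translation by constants, which makes
-- x ↦ x^q on F_q[t] the substitution t ↦ t^q. The same product, taken at X = E_h(x), combines q
-- blocks of length q^h into one of length q^(h+1).
--
-- Since A/gA may have zero divisors, a triangular system with diagonal entries k! determines only
-- the products of the coefficients with k!. Elimination still works: an entry (aₖ)ⱼ with j < k is a
-- multiple of j!, hence killed by the coefficient at j. So uniqueness, like existence, rests on
-- Carlitz's divisibility.
--
-- Congruence modulo g is treated as the equality of a ring with the same carrier and operations as
-- A, so that the lemmas on sums and Newton bases apply to it as they stand. The coefficient bound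
-- allows any gcd, and two normal forms may use different ones; what is compared is the degree of
-- the cofactors.

open RingMorphisms using (IsRingHomomorphism)

-- The library's ring solver needs decidable coefficients to cancel terms;
-- here they are integers.
module IntegerSolver {c ℓ} (R : CommutativeRing c ℓ) where
  open CommutativeRing R hiding (zero)
  open RingProperties ring
  open Mult semiring using (×-homo-+) renaming (_×_ to _·_)
  open SetoidReasoning setoid

  private
    ⟦_⟧ : ℤ → Carrier
    ⟦ + n ⟧      = n · 1#
    ⟦ -[1+ n ] ⟧ = - (suc n · 1#)

    x≈x-0 : ∀ x → x ≈ x - 0#
    x≈x-0 x = sym (trans (+-congˡ -0#≈0#) (+-identityʳ x))

    cancel : ∀ z x y → x - y ≈ (z + x) - (z + y)
    cancel z x y = begin
      x - y                ≈⟨ +-congʳ (xyx⁻¹≈y z x) ⟨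
      (z + x - z) - y      ≈⟨ +-assoc _ _ _ ⟩
      z + x + (- z - y)    ≈⟨ +-congˡ (-‿+-comm z y) ⟩
      (z + x) - (z + y)    ∎

    ⟦⊖⟧ : ∀ m n → ⟦ m ℤ.⊖ n ⟧ ≈ (m · 1#) - (n · 1#)
    ⟦⊖⟧ zero    zero    = x≈x-0 _
    ⟦⊖⟧ zero    (suc n) = sym (+-identityˡ _)
    ⟦⊖⟧ (suc m) zero    = x≈x-0 _
    ⟦⊖⟧ (suc m) (suc n) = begin
      ⟦ suc m ℤ.⊖ suc n ⟧          ≡⟨ ≡.cong ⟦_⟧ (ℤ.[1+m]⊖[1+n]≡m⊖n m n) ⟩
      ⟦ m ℤ.⊖ n ⟧                  ≈⟨ ⟦⊖⟧ m n ⟩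
      (m · 1#) - (n · 1#)          ≈⟨ cancel 1# _ _ ⟩
      (suc m · 1#) - (suc n · 1#)  ∎

    ⟦-⟧ : ∀ i → ⟦ ℤ.- i ⟧ ≈ - ⟦ i ⟧
    ⟦-⟧ (+ zero)     = sym -0#≈0#
    ⟦-⟧ (+ suc n)    = refl
    ⟦-⟧ -[1+ n ]     = sym (-‿involutive _)

    ⟦+⟧ : ∀ i j → ⟦ i ℤ.+ j ⟧ ≈ ⟦ i ⟧ + ⟦ j ⟧
    ⟦+⟧ (+ m)    (+ n)    = ×-homo-+ 1# m n
    ⟦+⟧ (+ m)    -[1+ n ] = ⟦⊖⟧ m (suc n)
    ⟦+⟧ -[1+ m ] (+ n)    = trans (⟦⊖⟧ n (suc m)) (+-comm _ _)
    ⟦+⟧ -[1+ m ] -[1+ n ] = begin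
      - (suc (suc (m ℕ.+ n)) · 1#)         ≡⟨ ≡.cong (λ k → - (k · 1#)) (≡.cong suc (≡.sym (ℕ.+-suc m n))) ⟩
      - ((suc m ℕ.+ suc n) · 1#)           ≈⟨ -‿cong (×-homo-+ 1# (suc m) (suc n)) ⟩
      - ((suc m · 1#) + (suc n · 1#))      ≈⟨ -‿+-comm _ _ ⟨
      - (suc m · 1#) - (suc n · 1#)        ∎

    ⟦+*⟧ : ∀ m j → ⟦ + m ℤ.* j ⟧ ≈ ⟦ + m ⟧ * ⟦ j ⟧
    ⟦+*⟧ zero    j = trans (reflexive (≡.cong ⟦_⟧ (ℤ.*-zeroˡ j))) (sym (zeroˡ _))
    ⟦+*⟧ (suc m) j = begin
      ⟦ + suc m ℤ.* j ⟧                ≡⟨ ≡.cong ⟦_⟧ (ℤ.suc-* (+ m) j) ⟩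
      ⟦ j ℤ.+ + m ℤ.* j ⟧              ≈⟨ ⟦+⟧ j (+ m ℤ.* j) ⟩
      ⟦ j ⟧ + ⟦ + m ℤ.* j ⟧            ≈⟨ +-cong (sym (*-identityˡ _)) (⟦+*⟧ m j) ⟩
      1# * ⟦ j ⟧ + (m · 1#) * ⟦ j ⟧    ≈⟨ distribʳ _ _ _ ⟨
      (suc m · 1#) * ⟦ j ⟧             ∎

    ⟦*⟧ : ∀ i j → ⟦ i ℤ.* j ⟧ ≈ ⟦ i ⟧ * ⟦ j ⟧
    ⟦*⟧ (+ m)    j = ⟦+*⟧ m j
    ⟦*⟧ -[1+ m ] j = begin
      ⟦ -[1+ m ] ℤ.* j ⟧       ≡⟨ ≡.cong ⟦_⟧ (≡.sym (ℤ.neg-distribˡ-* (+ suc m) j)) ⟩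
      ⟦ ℤ.- (+ suc m ℤ.* j) ⟧  ≈⟨ ⟦-⟧ (+ suc m ℤ.* j) ⟩
      - ⟦ + suc m ℤ.* j ⟧      ≈⟨ -‿cong (⟦+*⟧ (suc m) j) ⟩
      - (⟦ + suc m ⟧ * ⟦ j ⟧)  ≈⟨ -‿distribˡ-* _ _ ⟩
      - ⟦ + suc m ⟧ * ⟦ j ⟧    ∎

    ℤ⟶R : ACR._-Raw-AlmostCommutative⟶_ ℤ.+-*-rawRing (ACR.fromCommutativeRing R)
    ℤ⟶R = record
      { ⟦_⟧ = ⟦_⟧ ; +-homo = ⟦+⟧ ; *-homo = ⟦*⟧ ; -‿homo = ⟦-⟧
      ; 0-homo = refl ; 1-homo = +-identityʳ 1# }

    _coeff≟_ : ∀ i j → Maybe (⟦ i ⟧ ≈ ⟦ j ⟧)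
    i coeff≟ j with i ℤ.≟ j
    ... | yes ≡.refl = just refl
    ... | no _       = nothing

  open RingSolver ℤ.+-*-rawRing (ACR.fromCommutativeRing R) ℤ⟶R _coeff≟_ public
    using (solve; _:=_; _:+_; _:*_; _:-_; :-_; con)

-- Polynomials over a commutative ring form a commutative ring.

-- Multiplication of polynomials is convolution of their coefficient
-- sequences, and for arbitrary sequences the ring laws are inductions.
module PolynomialProperties {c ℓ} (R : CommutativeRing c ℓ) where
  open CommutativeRing R hiding (zero)
  open RingProperties ring
  open Polynomial rawRing hiding (polynomialRing)
  open SetoidReasoning setoid
  open IntegerSolver R

  private
    P : RawRing c ℓ
    P = polynomialRing rawRing
    module P = RawRing P

    convolution : (ℕ → Carrier) → (ℕ → Carrier) → ℕ → Carrier
    convolution s t zero    = s 0 * t 0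
    convolution s t (suc n) = s 0 * t (suc n) + convolution (s ∘ suc) t n

    conv-cong : ∀ {s s′ t t′} → (∀ n → s n ≈ s′ n) → (∀ n → t n ≈ t′ n) →
                ∀ n → convolution s t n ≈ convolution s′ t′ n
    conv-cong s≈ t≈ zero    = *-cong (s≈ 0) (t≈ 0)
    conv-cong s≈ t≈ (suc n) =
      +-cong (*-cong (s≈ 0) (t≈ (suc n))) (conv-cong (s≈ ∘ suc) t≈ n)

    conv-zeroˡ : ∀ t n → convolution (λ _ → 0#) t n ≈ 0#
    conv-zeroˡ t zero    = zeroˡ _
    conv-zeroˡ t (suc n) = trans (+-cong (zeroˡ _) (conv-zeroˡ t n)) (+-identityˡ _)

    conv-scaleˡ : ∀ x s t n → convolution (λ i → x * s i) t n ≈ x * convolution s t n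
    conv-scaleˡ x s t zero    = *-assoc _ _ _
    conv-scaleˡ x s t (suc n) = trans
      (+-cong (*-assoc _ _ _) (conv-scaleˡ x (s ∘ suc) t n)) (sym (distribˡ _ _ _))

    conv-distribʳ : ∀ s s′ t n →
      convolution (λ i → s i + s′ i) t n ≈ convolution s t n + convolution s′ t n
    conv-distribʳ s s′ t zero    = distribʳ _ _ _
    conv-distribʳ s s′ t (suc n) = trans
      (+-congˡ (conv-distribʳ (s ∘ suc) (s′ ∘ suc) t n))
      (solve 5 (λ x y z u v → (x :+ y) :* z :+ (u :+ v) := (x :* z :+ u) :+ (y :* z :+ v))
        refl _ _ _ _ _)

    -- `convolution` peels off the first entry of `s`. Peeling from the other end turns
    -- commutativity into an induction.
    conv-sucʳ : ∀ s t n →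
      convolution s t (suc n) ≈ convolution s (t ∘ suc) n + s (suc n) * t 0
    conv-sucʳ s t zero    = refl
    conv-sucʳ s t (suc n) = trans (+-congˡ (conv-sucʳ (s ∘ suc) t n)) (sym (+-assoc _ _ _))

    conv-comm : ∀ s t n → convolution s t n ≈ convolution t s n
    conv-comm s t zero    = *-comm _ _
    conv-comm s t (suc n) = begin
      s 0 * t (suc n) + convolution (s ∘ suc) t n  ≈⟨ +-cong (*-comm _ _) (conv-comm (s ∘ suc) t n) ⟩
      t (suc n) * s 0 + convolution t (s ∘ suc) n  ≈⟨ +-comm _ _ ⟩
      convolution t (s ∘ suc) n + t (suc n) * s 0  ≈⟨ conv-sucʳ t s n ⟨
      convolution t s (suc n)                      ∎

    conv-assoc : ∀ s t u n →
      convolution (convolution s t) u n ≈ convolution s (convolution t u) n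
    conv-assoc s t u zero    = *-assoc _ _ _
    conv-assoc s t u (suc n) = begin
      s 0 * t 0 * u (suc n) + convolution (λ i → s 0 * t (suc i) + convolution (s ∘ suc) t i) u n
        ≈⟨ +-congˡ (conv-distribʳ _ _ u n) ⟩
      s 0 * t 0 * u (suc n) + (convolution (λ i → s 0 * t (suc i)) u n
                               + convolution (convolution (s ∘ suc) t) u n)
        ≈⟨ +-congˡ (+-cong (conv-scaleˡ _ _ u n) (conv-assoc (s ∘ suc) t u n)) ⟩
      s 0 * t 0 * u (suc n) + (s 0 * convolution (t ∘ suc) u n
                               + convolution (s ∘ suc) (convolution t u) n)
        ≈⟨ solve 5 (λ x y z v w → x :* y :* z :+ (x :* v :+ w) := x :* (y :* z :+ v) :+ w)
             refl _ _ _ _ _ ⟩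
      s 0 * (t 0 * u (suc n) + convolution (t ∘ suc) u n)
        + convolution (s ∘ suc) (convolution t u) n ∎

    conv-identityˡ : ∀ {s} → s 0 ≈ 1# → (∀ n → s (suc n) ≈ 0#) →
                     ∀ t n → convolution s t n ≈ t n
    conv-identityˡ s0 s+ t zero    = trans (*-congʳ s0) (*-identityˡ _)
    conv-identityˡ s0 s+ t (suc n) = trans
      (+-cong (trans (*-congʳ s0) (*-identityˡ _))
              (trans (conv-cong s+ (λ _ → refl) n) (conv-zeroˡ t n)))
      (+-identityʳ _)

  coeff-add : ∀ p q n → coeff (add p q) n ≈ coeff p n + coeff q n
  coeff-add []      q       n       = sym (+-identityˡ _)
  coeff-add (x ∷ p) []      n       = sym (+-identityʳ _)
  coeff-add (x ∷ p) (y ∷ q) zero    = refl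
  coeff-add (x ∷ p) (y ∷ q) (suc n) = coeff-add p q n

  coeff-scale : ∀ x p n → coeff (map (x *_) p) n ≈ x * coeff p n
  coeff-scale x []      n       = sym (zeroʳ x)
  coeff-scale x (y ∷ p) zero    = refl
  coeff-scale x (y ∷ p) (suc n) = coeff-scale x p n

  coeff-neg : ∀ p n → coeff (map (-_) p) n ≈ - coeff p n
  coeff-neg []      n       = sym -0#≈0#
  coeff-neg (y ∷ p) zero    = refl
  coeff-neg (y ∷ p) (suc n) = coeff-neg p n

  coeff-mul-∷ : ∀ x p q n →
    coeff (mul (x ∷ p) q) n ≈ x * coeff q n + coeff (0# ∷ mul p q) n
  coeff-mul-∷ x p q n =
    trans (coeff-add (map (x *_) q) _ n) (+-congʳ (coeff-scale x q n))

  private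
    coeff-mul : ∀ p q n → coeff (mul p q) n ≈ convolution (coeff p) (coeff q) n
    coeff-mul []      q n       = sym (conv-zeroˡ _ n)
    coeff-mul (x ∷ p) q zero    = trans (coeff-mul-∷ x p q 0) (+-identityʳ _)
    coeff-mul (x ∷ p) q (suc n) = trans (coeff-mul-∷ x p q (suc n)) (+-congˡ (coeff-mul p q n))

  isCommutativeRing-polynomial : IsCommutativeRing P._≈_ P._+_ P._*_ P.-_ P.0# P.1#
  isCommutativeRing-polynomial = record
    { isRing = record
      { +-isAbelianGroup = record
        { isGroup = record
          { isMonoid = record
            { isSemigroup = record
              { isMagma = record
                { isEquivalence = record
                  { refl  = λ n → refl
                  ; sym   = λ e n → sym (e n)
                  ; trans = λ e f n → trans (e n) (f n)
                  }
                ; ∙-cong = λ {p} {p′} {q} {q′} e f n →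
                    trans (coeff-add p q n) (trans (+-cong (e n) (f n)) (sym (coeff-add p′ q′ n)))
                }
              ; assoc = λ p q r n → begin
                  coeff (add (add p q) r) n            ≈⟨ coeff-add (add p q) r n ⟩
                  coeff (add p q) n + coeff r n        ≈⟨ +-congʳ (coeff-add p q n) ⟩
                  coeff p n + coeff q n + coeff r n    ≈⟨ +-assoc _ _ _ ⟩
                  coeff p n + (coeff q n + coeff r n)  ≈⟨ +-congˡ (coeff-add q r n) ⟨
                  coeff p n + coeff (add q r) n        ≈⟨ coeff-add p (add q r) n ⟨
                  coeff (add p (add q r)) n            ∎
              }
            ; identity = (λ p n → refl)
                       , (λ p n → trans (coeff-add p [] n) (+-identityʳ _))
            }
          ; inverse = (λ p n → trans (coeff-add (map (-_) p) p n)
                                 (trans (+-congʳ (coeff-neg p n)) (-‿inverseˡ _)))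
                    , (λ p n → trans (coeff-add p (map (-_) p) n)
                                 (trans (+-congˡ (coeff-neg p n)) (-‿inverseʳ _)))
          ; ⁻¹-cong = λ {p} {p′} e n →
              trans (coeff-neg p n) (trans (-‿cong (e n)) (sym (coeff-neg p′ n)))
          }
        ; comm = λ p q n →
            trans (coeff-add p q n) (trans (+-comm _ _) (sym (coeff-add q p n)))
        }
      ; *-cong     = λ {p} {p′} {q} {q′} e f n →
          trans (coeff-mul p q n) (trans (conv-cong e f n) (sym (coeff-mul p′ q′ n)))
      ; *-assoc    = λ p q r n → begin
          coeff (mul (mul p q) r) n
            ≈⟨ coeff-mul (mul p q) r n ⟩
          convolution (coeff (mul p q)) (coeff r) n
            ≈⟨ conv-cong (coeff-mul p q) (λ _ → refl) n ⟩
          convolution (convolution (coeff p) (coeff q)) (coeff r) n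
            ≈⟨ conv-assoc _ _ _ n ⟩
          convolution (coeff p) (convolution (coeff q) (coeff r)) n
            ≈⟨ conv-cong {coeff p} (λ _ → refl) (coeff-mul q r) n ⟨
          convolution (coeff p) (coeff (mul q r)) n
            ≈⟨ coeff-mul p (mul q r) n ⟨
          coeff (mul p (mul q r)) n ∎
      ; *-identity = identityˡ
                   , (λ p n → trans (mul-comm p P.1# n) (identityˡ p n))
      ; distrib    = (λ p q r n → begin
                        coeff (mul p (add q r)) n                     ≈⟨ mul-comm p (add q r) n ⟩
                        coeff (mul (add q r) p) n                     ≈⟨ distribʳ′ p q r n ⟩
                        coeff (add (mul q p) (mul r p)) n             ≈⟨ coeff-add (mul q p) (mul r p) n ⟩
                        coeff (mul q p) n + coeff (mul r p) n         ≈⟨ +-cong (mul-comm q p n) (mul-comm r p n) ⟩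
                        coeff (mul p q) n + coeff (mul p r) n         ≈⟨ coeff-add (mul p q) (mul p r) n ⟨
                        coeff (add (mul p q) (mul p r)) n             ∎)
                   , distribʳ′
      }
    ; *-comm = mul-comm
    }
    where
    identityˡ : ∀ p n → coeff (mul P.1# p) n ≈ coeff p n
    identityˡ p n = trans (coeff-mul P.1# p n) (conv-identityˡ refl (λ _ → refl) (coeff p) n)

    mul-comm : ∀ p q n → coeff (mul p q) n ≈ coeff (mul q p) n
    mul-comm p q n =
      trans (coeff-mul p q n) (trans (conv-comm (coeff p) (coeff q) n) (sym (coeff-mul q p n)))

    distribʳ′ : ∀ r p q n → coeff (mul (add p q) r) n ≈ coeff (add (mul p r) (mul q r)) n
    distribʳ′ r p q n = begin
      coeff (mul (add p q) r) n                       ≈⟨ coeff-mul (add p q) r n ⟩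
      convolution (coeff (add p q)) (coeff r) n       ≈⟨ conv-cong (coeff-add p q) (λ _ → refl) n ⟩
      convolution (λ i → coeff p i + coeff q i) (coeff r) n
                                                      ≈⟨ conv-distribʳ (coeff p) (coeff q) (coeff r) n ⟩
      convolution (coeff p) (coeff r) n + convolution (coeff q) (coeff r) n
                                                      ≈⟨ +-cong (coeff-mul p r n) (coeff-mul q r n) ⟨
      coeff (mul p r) n + coeff (mul q r) n           ≈⟨ coeff-add (mul p r) (mul q r) n ⟨
      coeff (add (mul p r) (mul q r)) n               ∎

  polynomialCommutativeRing : CommutativeRing c ℓ
  polynomialCommutativeRing = record { isCommutativeRing = isCommutativeRing-polynomial }

-- Congruence modulo g as the equality of a ring.

module Quotient {c ℓ} (R : CommutativeRing c ℓ) (g : CommutativeRing.Carrier R) where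
  open CommutativeRing R hiding (zero)
  open RawRingOps rawRing using (_≡_[mod_]; _∣_)
  open import Algebra.Definitions.RawMagma *-rawMagma using (_,_)
  open IntegerSolver R
  open RingProperties ring

  infix 4 _∼_
  _∼_ : Carrier → Carrier → Set _
  x ∼ y = x ≡ y [mod g ]

  ≈⇒∼ : ∀ {x y} → x ≈ y → x ∼ y
  ≈⇒∼ {x} {y} x≈y = 0# , trans (zeroˡ g) (sym (trans (+-congʳ x≈y) (-‿inverseʳ y)))

  ∣⇒∼0 : ∀ {x} → g ∣ x → x ∼ 0#
  ∣⇒∼0 {x} (u , p) = u , trans p (sym (trans (+-congˡ -0#≈0#) (+-identityʳ x)))

  ∼0⇒∣ : ∀ {x} → x ∼ 0# → g ∣ x
  ∼0⇒∣ {x} (u , p) = u , trans p (trans (+-congˡ -0#≈0#) (+-identityʳ x))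

  -- Only the equality is coarsened. An expression in R is literally an expression in the quotient,
  -- and no projection map intervenes.
  quotientRing : CommutativeRing _ _
  quotientRing = record
    { Carrier = Carrier ; _≈_ = _∼_ ; _+_ = _+_ ; _*_ = _*_ ; -_ = -_ ; 0# = 0# ; 1# = 1#
    ; isCommutativeRing = record
      { isRing = record
        { +-isAbelianGroup = record
          { isGroup = record
            { isMonoid = record
              { isSemigroup = record
                { isMagma = record
                  { isEquivalence = record
                    { refl  = ≈⇒∼ refl
                    ; sym   = λ { {x} {y} (u , p) → - u ,
                        trans (sym (-‿distribˡ-* u g)) (trans (-‿cong p)
                          (solve 2 (λ x y → :- (x :- y) := y :- x) refl x y)) }
                    ; trans = λ { {x} {y} {z} (u , p) (v , p′) → u + v ,
                        trans (distribʳ g u v) (trans (+-cong p p′)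
                          (solve 3 (λ x y z → (x :- y) :+ (y :- z) := x :- z) refl x y z)) }
                    }
                  ; ∙-cong = λ { {x} {x′} {y} {y′} (u , p) (v , p′) → u + v ,
                      trans (distribʳ g u v) (trans (+-cong p p′)
                        (solve 4 (λ x x′ y y′ → (x :- x′) :+ (y :- y′) := (x :+ y) :- (x′ :+ y′))
                          refl x x′ y y′)) }
                  }
                ; assoc = λ x y z → ≈⇒∼ (+-assoc x y z)
                }
              ; identity = (λ x → ≈⇒∼ (+-identityˡ x)) , (λ x → ≈⇒∼ (+-identityʳ x))
              }
            ; inverse = (λ x → ≈⇒∼ (-‿inverseˡ x)) , (λ x → ≈⇒∼ (-‿inverseʳ x))
            ; ⁻¹-cong = λ { {x} {y} (u , p) → - u ,
                trans (sym (-‿distribˡ-* u g)) (trans (-‿cong p)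
                  (solve 2 (λ x y → :- (x :- y) := :- x :- :- y) refl x y)) }
            }
          ; comm = λ x y → ≈⇒∼ (+-comm x y)
          }
        -- The witness comes from x y - x′ y′ = (x - x′) y + x′ (y - y′).
        ; *-cong     = λ { {x} {x′} {y} {y′} (u , p) (v , p′) → u * y + x′ * v ,
            trans (solve 5 (λ u y x v g → (u :* y :+ x :* v) :* g := u :* g :* y :+ x :* (v :* g))
                    refl u y x′ v g)
              (trans (+-cong (*-congʳ p) (*-congˡ p′))
                (solve 4 (λ x x′ y y′ → (x :- x′) :* y :+ x′ :* (y :- y′) := x :* y :- x′ :* y′)
                  refl x x′ y y′)) }
        ; *-assoc    = λ x y z → ≈⇒∼ (*-assoc x y z)
        ; *-identity = (λ x → ≈⇒∼ (*-identityˡ x)) , (λ x → ≈⇒∼ (*-identityʳ x))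
        ; distrib    = (λ x y z → ≈⇒∼ (distribˡ x y z)) , (λ x y z → ≈⇒∼ (distribʳ x y z))
        }
      ; *-comm = λ x y → ≈⇒∼ (*-comm x y)
      }
    }

-- Finite sums and products, and the Newton basis.

-- These depend on the operations alone, so that they agree definitionally
-- in a ring and in its quotients.
module RawBigOperators {c} {Carrier : Set c}
  (_+_ _*_ : Carrier → Carrier → Carrier) (-_ : Carrier → Carrier) (0# 1# : Carrier) where

  ∑ : ℕ → (ℕ → Carrier) → Carrier
  ∑ zero    f = 0#
  ∑ (suc n) f = f 0 + ∑ n λ i → f (suc i)

  ∏ : ℕ → (ℕ → Carrier) → Carrier
  ∏ zero    f = 1#
  ∏ (suc n) f = f 0 * ∏ n λ i → f (suc i)

  boxSum : ∀ {r} → Vec ℕ r → (Vec ℕ r → Carrier) → Carrier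
  boxSum []       h = h []
  boxSum (m ∷ ms) h = ∑ m λ k → boxSum ms λ ks → h (k ∷ ks)

  module RawNewton (a : ℕ → Carrier) where
    falling : ℕ → Carrier → Carrier
    falling k x = ∏ k λ j → x + (- a j)

    factorials : ∀ {r} → Vec ℕ r → Carrier
    factorials []       = 1#
    factorials (k ∷ ks) = falling k (a k) * factorials ks

    fallings : ∀ {r} → Vec ℕ r → Vec Carrier r → Carrier
    fallings []       []       = 1#
    fallings (k ∷ ks) (x ∷ xs) = falling k x * fallings ks xs

module BigOperators {c ℓ} (R : CommutativeRing c ℓ) where
  open CommutativeRing R hiding (zero)
  open SetoidReasoning setoid
  open Exp commutativeSemiring using (_^_)
  open RawRingOps rawRing using (sumOver; product)
  open CommutativeSemigroupProperties +-commutativeSemigroup using () renaming (interchange to +-interchange)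
  open CommutativeSemigroupProperties *-commutativeSemigroup using () renaming (interchange to *-interchange)

  open RawBigOperators _+_ _*_ -_ 0# 1# public

  product-toℕ : ∀ n f → product {n} (λ i → f (toℕ i)) ≡ ∏ n f
  product-toℕ zero    f = ≡.refl
  product-toℕ (suc n) f = ≡.cong (f 0 *_) (product-toℕ n (f ∘ suc))

  ∑-cong : ∀ n {f h} → (∀ i → i < n → f i ≈ h i) → ∑ n f ≈ ∑ n h
  ∑-cong zero    e = refl
  ∑-cong (suc n) e = +-cong (e 0 (s≤s z≤n)) (∑-cong n λ i i<n → e (suc i) (s≤s i<n))

  ∏-cong : ∀ n {f h} → (∀ i → i < n → f i ≈ h i) → ∏ n f ≈ ∏ n h
  ∏-cong zero    e = refl
  ∏-cong (suc n) e = *-cong (e 0 (s≤s z≤n)) (∏-cong n λ i i<n → e (suc i) (s≤s i<n))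

  ∑-+ : ∀ n f h → ∑ n (λ i → f i + h i) ≈ ∑ n f + ∑ n h
  ∑-+ zero    f h = sym (+-identityˡ _)
  ∑-+ (suc n) f h = trans (+-congˡ (∑-+ n _ _)) (+-interchange _ _ _ _)

  ∑-scale : ∀ n x f → ∑ n (λ i → x * f i) ≈ x * ∑ n f
  ∑-scale zero    x f = sym (zeroʳ x)
  ∑-scale (suc n) x f = trans (+-congˡ (∑-scale n x _)) (sym (distribˡ _ _ _))

  ∑-zero : ∀ n {f} → (∀ i → i < n → f i ≈ 0#) → ∑ n f ≈ 0#
  ∑-zero zero    e = refl
  ∑-zero (suc n) e =
    trans (+-cong (e 0 (s≤s z≤n)) (∑-zero n λ i i<n → e (suc i) (s≤s i<n))) (+-identityˡ 0#)

  ∑-single : ∀ {n k} f → k < n → (∀ i → i < n → i ≢ k → f i ≈ 0#) → ∑ n f ≈ f k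
  ∑-single {suc n} {zero}  f _         e =
    trans (+-congˡ (∑-zero n λ i i<n → e (suc i) (s≤s i<n) λ ())) (+-identityʳ _)
  ∑-single {suc n} {suc k} f (s≤s k<n) e =
    trans (+-cong (e 0 (s≤s z≤n) λ ())
                  (∑-single (f ∘ suc) k<n λ i i<n i≢k → e (suc i) (s≤s i<n) (i≢k ∘ ℕ.suc-injective)))
          (+-identityˡ _)

  ∑-last : ∀ n f → ∑ (suc n) f ≈ ∑ n f + f n
  ∑-last zero    f = +-comm _ _
  ∑-last (suc n) f = trans (+-congˡ (∑-last n (f ∘ suc))) (sym (+-assoc _ _ _))

  ∏-last : ∀ n f → ∏ (suc n) f ≈ ∏ n f * f n
  ∏-last zero    f = *-comm _ _
  ∏-last (suc n) f = trans (*-congˡ (∏-last n (f ∘ suc))) (sym (*-assoc _ _ _))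

  ∏-zero : ∀ {n i} f → i < n → f i ≈ 0# → ∏ n f ≈ 0#
  ∏-zero {suc n} {zero}  f _         e = trans (*-congʳ e) (zeroˡ _)
  ∏-zero {suc n} {suc i} f (s≤s i<n) e = trans (*-congˡ (∏-zero (f ∘ suc) i<n e)) (zeroʳ _)

  ∏-+ : ∀ m n f → ∏ (m ℕ.+ n) f ≈ ∏ m f * ∏ n (λ j → f (m ℕ.+ j))
  ∏-+ zero    n f = sym (*-identityˡ _)
  ∏-+ (suc m) n f = trans (*-congˡ (∏-+ m n (f ∘ suc))) (sym (*-assoc _ _ _))

  -- Cuts the range into m blocks of length n. With n = q^h, a block collects the indices that agree
  -- in all base-q digits from place h upwards.
  ∏-* : ∀ m n f → ∏ (m ℕ.* n) f ≈ ∏ m λ i → ∏ n λ j → f (i ℕ.* n ℕ.+ j)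
  ∏-* zero    n f = refl
  ∏-* (suc m) n f = begin
    ∏ (n ℕ.+ m ℕ.* n) f
      ≈⟨ ∏-+ n (m ℕ.* n) f ⟩
    ∏ n f * ∏ (m ℕ.* n) (λ j → f (n ℕ.+ j))
      ≈⟨ *-congˡ (∏-* m n _) ⟩
    ∏ n f * ∏ m (λ i → ∏ n λ j → f (n ℕ.+ (i ℕ.* n ℕ.+ j)))
      ≈⟨ *-congˡ (∏-cong m λ i _ → ∏-cong n λ j _ →
           reflexive (≡.cong f (≡.sym (ℕ.+-assoc n (i ℕ.* n) j)))) ⟩
    ∏ (suc m) (λ i → ∏ n λ j → f (i ℕ.* n ℕ.+ j)) ∎

  ∏-scale : ∀ n x f → ∏ n (λ i → x * f i) ≈ x ^ n * ∏ n f
  ∏-scale zero    x f = sym (*-identityˡ _)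
  ∏-scale (suc n) x f = trans (*-congˡ (∏-scale n x _)) (*-interchange _ _ _ _)

  sumOver-multiIndices : ∀ {r} (ms : Vec ℕ r) h → sumOver (multiIndices ms) h ≈ boxSum ms h
  sumOver-multiIndices []       h = +-identityʳ _
  sumOver-multiIndices (m ∷ ms) h = outer m id
    where
    sumOver-++ : ∀ is js → sumOver (is ++ js) h ≈ sumOver is h + sumOver js h
    sumOver-++ []       js = sym (+-identityˡ _)
    sumOver-++ (i ∷ is) js = trans (+-congˡ (sumOver-++ is js)) (sym (+-assoc _ _ _))

    -- `upTo` is `applyUpTo id`, whose tail applies a shifted function; the induction therefore runs
    -- over an arbitrary `f`.
    outer : ∀ n (f : ℕ → ℕ) →
      sumOver (List.cartesianProductWith _∷_ (applyUpTo f n) (multiIndices ms)) h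
        ≈ ∑ n λ k → boxSum ms λ ks → h (f k ∷ ks)
    outer zero    f = refl
    outer (suc n) f = begin
      sumOver (map (f 0 ∷_) (multiIndices ms) ++ rest) h
        ≈⟨ sumOver-++ (map (f 0 ∷_) (multiIndices ms)) rest ⟩
      sumOver (map (f 0 ∷_) (multiIndices ms)) h + sumOver rest h
        ≡⟨ ≡.cong (λ is → foldr _+_ 0# is + sumOver rest h) (≡.sym (List.map-∘ (multiIndices ms))) ⟩
      sumOver (multiIndices ms) (λ ks → h (f 0 ∷ ks)) + sumOver rest h
        ≈⟨ +-cong (sumOver-multiIndices ms _) (outer n (f ∘ suc)) ⟩
      boxSum ms (λ ks → h (f 0 ∷ ks)) + ∑ n (λ k → boxSum ms λ ks → h (f (suc k) ∷ ks)) ∎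
      where rest = List.cartesianProductWith _∷_ (applyUpTo (f ∘ suc) n) (multiIndices ms)

  boxSum-cong : ∀ {r} {ms : Vec ℕ r} {h h′} →
    (∀ ks → Pointwise _<_ ks ms → h ks ≈ h′ ks) → boxSum ms h ≈ boxSum ms h′
  boxSum-cong {ms = []}     e = e [] []
  boxSum-cong {ms = m ∷ ms} e =
    ∑-cong m λ k k<m → boxSum-cong λ ks ks<ms → e (k ∷ ks) (k<m ∷ ks<ms)

  boxSum-+ : ∀ {r} (ms : Vec ℕ r) h h′ →
    boxSum ms (λ ks → h ks + h′ ks) ≈ boxSum ms h + boxSum ms h′
  boxSum-+ []       h h′ = refl
  boxSum-+ (m ∷ ms) h h′ = trans
    (∑-cong m λ k _ → boxSum-+ ms _ _) (∑-+ m _ _)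

  boxSum-scale : ∀ {r} (ms : Vec ℕ r) x h → boxSum ms (λ ks → x * h ks) ≈ x * boxSum ms h
  boxSum-scale []       x h = refl
  boxSum-scale (m ∷ ms) x h = trans
    (∑-cong m λ k _ → boxSum-scale ms x _) (∑-scale m x _)

module Newton {c ℓ} (R : CommutativeRing c ℓ) (a : ℕ → CommutativeRing.Carrier R) where
  open CommutativeRing R hiding (zero)
  open BigOperators R
  open RawNewton a public
  open SetoidReasoning setoid
  open IntegerSolver R
  open RawRingOps rawRing using (_∣_)
  open import Algebra.Definitions.RawMagma *-rawMagma using (_,_)
  open CommutativeSemigroupProperties *-commutativeSemigroup using (x∙yz≈y∙xz)

  falling-cong : ∀ k {x y} → x ≈ y → falling k x ≈ falling k y
  falling-cong k x≈y = ∏-cong k λ _ _ → +-congʳ x≈y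

  falling-zero : ∀ {k j x} → j < k → x ≈ a j → falling k x ≈ 0#
  falling-zero {j = j} j<k x≈aⱼ = ∏-zero _ j<k (trans (+-congʳ x≈aⱼ) (-‿inverseʳ (a j)))


  -- x (x)ₖ = (x)ₖ₊₁ + aₖ (x)ₖ
  shift : (ℕ → Carrier) → ℕ → Carrier
  shift e zero    = a 0 * e 0
  shift e (suc k) = a (suc k) * e (suc k) + e k

  -- Multiplication by x in the Newton basis. The top coefficient spills over into (x)ₙ₊₁, kept as a
  -- separate term because it is the one that will vanish modulo g.
  *-newton : ∀ n e x →
    x * ∑ (suc n) (λ k → e k * falling k x)
      ≈ ∑ (suc n) (λ k → shift e k * falling k x) + e n * falling (suc n) x
  *-newton zero    e x = solve 4
    (λ x e a o → x :* (e :* o :+ con 0ℤ)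
                   := (a :* e) :* o :+ con 0ℤ :+ e :* ((x :- a) :* o))
    refl x (e 0) (a 0) 1#
  *-newton (suc n) e x = begin
    x * ∑ (suc (suc n)) (λ k → e k * falling k x)
      ≈⟨ *-congˡ (∑-last (suc n) (λ k → e k * falling k x)) ⟩
    x * (∑ (suc n) (λ k → e k * falling k x) + e (suc n) * falling (suc n) x)
      ≈⟨ distribˡ _ _ _ ⟩
    x * ∑ (suc n) (λ k → e k * falling k x) + x * (e (suc n) * falling (suc n) x)
      ≈⟨ +-congʳ (*-newton n e x) ⟩
    S + e n * falling (suc n) x + x * (e (suc n) * falling (suc n) x)
      ≈⟨ solve 6 (λ S eₙ F x e a → S :+ eₙ :* F :+ x :* (e :* F)
                   := S :+ (a :* e :+ eₙ) :* F :+ e :* (F :* (x :- a)))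
           refl S (e n) _ x (e (suc n)) (a (suc n)) ⟩
    S + shift e (suc n) * falling (suc n) x + e (suc n) * (falling (suc n) x * (x - a (suc n)))
      ≈⟨ +-cong (∑-last (suc n) (λ k → shift e k * falling k x))
                (*-congˡ (∏-last (suc n) λ j → x - a j)) ⟨
    ∑ (suc (suc n)) (λ k → shift e k * falling k x) + e (suc n) * falling (suc (suc n)) x ∎
    where S = ∑ (suc n) λ k → shift e k * falling k x

  boxSum-factor : ∀ {r} (ms : Vec ℕ r) f xs (h : Vec ℕ r → Carrier) →
    boxSum ms (λ ks → h ks * (f * fallings ks xs)) ≈ boxSum ms (λ ks → h ks * fallings ks xs) * f
  boxSum-factor ms f xs h = begin
    boxSum ms (λ ks → h ks * (f * fallings ks xs))  ≈⟨ boxSum-cong {ms = ms} (λ ks _ → x∙yz≈y∙xz (h ks) _ _) ⟩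
    boxSum ms (λ ks → f * (h ks * fallings ks xs))  ≈⟨ boxSum-scale ms f _ ⟩
    f * boxSum ms (λ ks → h ks * fallings ks xs)    ≈⟨ *-comm _ _ ⟩
    boxSum ms (λ ks → h ks * fallings ks xs) * f    ∎

  module Triangular (factorial∣falling : ∀ k x → falling k (a k) ∣ falling k x) where

    -- falling j (a k) vanishes for j > k, and for j < k it is a multiple of
    -- the j-th factorial, which kills e j by induction.
    triangular₁ : ∀ m (e : ℕ → Carrier) → (∀ k → k < m → ∑ m (λ j → e j * falling j (a k)) ≈ 0#) →
                  ∀ k → k < m → e k * falling k (a k) ≈ 0#
    triangular₁ m e vanish = <-rec _ step
      where
      step : ∀ k → (∀ {j} → j < k → j < m → e j * falling j (a j) ≈ 0#) →
             k < m → e k * falling k (a k) ≈ 0#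
      step k rec k<m = trans (sym (∑-single _ k<m other)) (vanish k k<m)
        where
        other : ∀ j → j < m → j ≢ k → e j * falling j (a k) ≈ 0#
        other j j<m j≢k with ℕ.<-cmp j k
        ... | tri≈ _ j≡k _ = contradiction j≡k j≢k
        ... | tri> _ _ k<j = trans (*-congˡ (falling-zero k<j refl)) (zeroʳ _)
        ... | tri< j<k _ _ with factorial∣falling j (a k)
        ...   | w , w*j!≈ = begin
          e j * falling j (a k)         ≈⟨ *-congˡ w*j!≈ ⟨
          e j * (w * falling j (a j))   ≈⟨ x∙yz≈y∙xz _ _ _ ⟩
          w * (e j * falling j (a j))   ≈⟨ *-congˡ (rec j<k j<m) ⟩
          w * 0#                        ≈⟨ zeroʳ w ⟩
          0#                            ∎

    -- One coordinate at a time: with the remaining coordinates of the point fixed, the inner box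
    -- sums are the coefficients of a one-variable system in the first index. `triangular₁` isolates
    -- the sum at k times k!, and this factor is absorbed into `δ` for the remaining coordinates.
    triangular : ∀ {r} (ms : Vec ℕ r) (δ : Vec ℕ r → Carrier) →
      (∀ ks → Pointwise _<_ ks ms → boxSum ms (λ js → δ js * fallings js (Vec.map a ks)) ≈ 0#) →
      ∀ ks → Pointwise _<_ ks ms → δ ks * factorials ks ≈ 0#
    triangular []       δ vanish []       []              = vanish [] []
    triangular (m ∷ ms) δ vanish (k ∷ ks) (k<m ∷ ks<ms) =
      trans (sym (*-assoc _ _ _)) (triangular ms (λ js → δ (k ∷ js) * falling k (a k)) vanish′ ks ks<ms)
      where
      vanish′ : ∀ is → Pointwise _<_ is ms →
        boxSum ms (λ js → δ (k ∷ js) * falling k (a k) * fallings js (Vec.map a is)) ≈ 0#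
      vanish′ is is<ms = begin
        boxSum ms (λ js → δ (k ∷ js) * falling k (a k) * fallings js (Vec.map a is))
          ≈⟨ boxSum-cong {ms = ms} (λ js _ → *-assoc _ _ _) ⟩
        boxSum ms (λ js → δ (k ∷ js) * (falling k (a k) * fallings js (Vec.map a is)))
          ≈⟨ boxSum-factor ms (falling k (a k)) _ _ ⟩
        boxSum ms (λ js → δ (k ∷ js) * fallings js (Vec.map a is)) * falling k (a k)
          ≈⟨ triangular₁ m (λ j → boxSum ms λ js → δ (j ∷ js) * fallings js (Vec.map a is))
               (λ i i<m → trans (∑-cong m λ j _ → sym (boxSum-factor ms (falling j (a i)) _ _))
                                (vanish (i ∷ is) (i<m ∷ is<ms)))
               k k<m ⟩
        0# ∎

-- Evaluation homomorphisms, in one and in several variables.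

module PolynomialEvaluation
  {c ℓ c′ ℓ′} (R : CommutativeRing c ℓ) (S : CommutativeRing c′ ℓ′)
  {ε : CommutativeRing.Carrier R → CommutativeRing.Carrier S}
  (ε-hom : IsRingHomomorphism (CommutativeRing.rawRing R) (CommutativeRing.rawRing S) ε)
  (b : CommutativeRing.Carrier S) where

  private
    module R = CommutativeRing R
    module ε = IsRingHomomorphism ε-hom
  open CommutativeRing S hiding (zero)
  open RingProperties ring
  open IntegerSolver S
  open SetoidReasoning setoid
  open Polynomial R.rawRing using (coeff; add; mul)

  evaluate : List R.Carrier → Carrier
  evaluate = foldr (λ x rest → ε x + b * rest) 0#

  private
    evaluate-zero : ∀ p → (∀ n → coeff p n R.≈ R.0#) → evaluate p ≈ 0#
    evaluate-zero []      p≈0 = refl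
    evaluate-zero (x ∷ p) p≈0 = begin
      ε x + b * evaluate p  ≈⟨ +-cong (ε.⟦⟧-cong (p≈0 0)) (*-congˡ (evaluate-zero p (p≈0 ∘ suc))) ⟩
      ε R.0# + b * 0#       ≈⟨ +-cong ε.0#-homo (zeroʳ b) ⟩
      0# + 0#               ≈⟨ +-identityˡ 0# ⟩
      0#                    ∎

    evaluate-cong : ∀ p q → (∀ n → coeff p n R.≈ coeff q n) → evaluate p ≈ evaluate q
    evaluate-cong []      q       e = sym (evaluate-zero q (R.sym ∘ e))
    evaluate-cong (x ∷ p) []      e = evaluate-zero (x ∷ p) e
    evaluate-cong (x ∷ p) (y ∷ q) e =
      +-cong (ε.⟦⟧-cong (e 0)) (*-congˡ (evaluate-cong p q (e ∘ suc)))

    evaluate-add : ∀ p q → evaluate (add p q) ≈ evaluate p + evaluate q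
    evaluate-add []      q       = sym (+-identityˡ _)
    evaluate-add (x ∷ p) []      = sym (+-identityʳ _)
    evaluate-add (x ∷ p) (y ∷ q) = begin
      ε (x R.+ y) + b * evaluate (add p q)
        ≈⟨ +-cong (ε.+-homo x y) (*-congˡ (evaluate-add p q)) ⟩
      ε x + ε y + b * (evaluate p + evaluate q)
        ≈⟨ solve 5 (λ x y b p q → x :+ y :+ b :* (p :+ q) := (x :+ b :* p) :+ (y :+ b :* q))
             refl _ _ b _ _ ⟩
      (ε x + b * evaluate p) + (ε y + b * evaluate q) ∎

    evaluate-scale : ∀ x p → evaluate (map (x R.*_) p) ≈ ε x * evaluate p
    evaluate-scale x []      = sym (zeroʳ _)
    evaluate-scale x (y ∷ p) = begin
      ε (x R.* y) + b * evaluate (map (x R.*_) p)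
        ≈⟨ +-cong (ε.*-homo x y) (*-congˡ (evaluate-scale x p)) ⟩
      ε x * ε y + b * (ε x * evaluate p)
        ≈⟨ solve 4 (λ x y b p → x :* y :+ b :* (x :* p) := x :* (y :+ b :* p)) refl _ _ b _ ⟩
      ε x * (ε y + b * evaluate p) ∎

    evaluate-mul : ∀ p q → evaluate (mul p q) ≈ evaluate p * evaluate q
    evaluate-mul []      q = sym (zeroˡ _)
    evaluate-mul (x ∷ p) q = begin
      evaluate (add (map (x R.*_) q) (R.0# ∷ mul p q))
        ≈⟨ evaluate-add (map (x R.*_) q) _ ⟩
      evaluate (map (x R.*_) q) + (ε R.0# + b * evaluate (mul p q))
        ≈⟨ +-cong (evaluate-scale x q)
             (trans (+-cong ε.0#-homo (*-congˡ (evaluate-mul p q))) (+-identityˡ _)) ⟩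
      ε x * evaluate q + b * (evaluate p * evaluate q)
        ≈⟨ solve 4 (λ x b p q → x :* q :+ b :* (p :* q) := (x :+ b :* p) :* q) refl _ b _ _ ⟩
      (ε x + b * evaluate p) * evaluate q ∎

    evaluate-neg : ∀ p → evaluate (map R.-_ p) ≈ - evaluate p
    evaluate-neg []      = sym -0#≈0#
    evaluate-neg (x ∷ p) = begin
      ε (R.- x) + b * evaluate (map R.-_ p)  ≈⟨ +-cong (ε.-‿homo x) (*-congˡ (evaluate-neg p)) ⟩
      - ε x + b * - evaluate p               ≈⟨ solve 3 (λ x b p → :- x :+ b :* :- p := :- (x :+ b :* p)) refl _ b _ ⟩
      - (ε x + b * evaluate p)               ∎

  evaluate-constant : ∀ x → evaluate (x ∷ []) ≈ ε x
  evaluate-constant x = trans (+-congˡ (zeroʳ b)) (+-identityʳ _)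

  evaluate-variable : evaluate (R.0# ∷ R.1# ∷ []) ≈ b
  evaluate-variable = begin
    ε R.0# + b * evaluate (R.1# ∷ [])  ≈⟨ +-cong ε.0#-homo (*-congˡ (trans (evaluate-constant R.1#) ε.1#-homo)) ⟩
    0# + b * 1#                        ≈⟨ +-identityˡ _ ⟩
    b * 1#                             ≈⟨ *-identityʳ b ⟩
    b                                  ∎

  evaluate-isRingHomomorphism : IsRingHomomorphism (polynomialRing R.rawRing) rawRing evaluate
  evaluate-isRingHomomorphism = record
    { isSemiringHomomorphism = record
      { isNearSemiringHomomorphism = record
        { +-isMonoidHomomorphism = record
          { isMagmaHomomorphism = record
            { isRelHomomorphism = record { cong = λ {p} {q} → evaluate-cong p q }
            ; homo = evaluate-add
            }
          ; ε-homo = refl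
          }
        ; *-homo = evaluate-mul
        }
      ; 1#-homo = trans (evaluate-constant R.1#) ε.1#-homo
      }
    ; -‿homo = evaluate-neg
    }

module RingHomomorphism {c ℓ c′ ℓ′} (R : RawRing c ℓ) (S : CommutativeRing c′ ℓ′)
  {φ : RawRing.Carrier R → CommutativeRing.Carrier S}
  (φ-hom : IsRingHomomorphism R (CommutativeRing.rawRing S) φ) where

  private
    module R where
      open RawRing R public
      open RawRingOps R public
    module φ = IsRingHomomorphism φ-hom
  open CommutativeRing S hiding (zero)
  open RawRingOps rawRing using (sumOver; product)

  product-homo : ∀ n (f : Fin n → R.Carrier) → φ (R.product f) ≈ product λ i → φ (f i)
  product-homo zero    f = φ.1#-homo
  product-homo (suc n) f = trans (φ.*-homo _ _) (*-congˡ (product-homo n (f ∘ suc)))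

  sumOver-homo : ∀ {i} {I : Set i} (is : List I) h → φ (R.sumOver is h) ≈ sumOver is (φ ∘ h)
  sumOver-homo []       h = φ.0#-homo
  sumOver-homo (i ∷ is) h = trans (φ.+-homo _ _) (+-congˡ (sumOver-homo is h))

module MultivariateProperties {c ℓ} (R : CommutativeRing c ℓ) where
  open CommutativeRing R hiding (zero)
  open Multivariate rawRing
  open SetoidReasoning setoid
  open BigOperators R using (product-toℕ; sumOver-multiIndices; boxSum; boxSum-cong)
  open RawRingOps rawRing using (sumOver; product)

  -- Defined together with its laws, so that for an unknown `r` its operations are already those of
  -- `multivariateRing`.
  multivariateCommutativeRing : ℕ → CommutativeRing c ℓ
  isCommutativeRing-multivariate : ∀ r → let module M = RawRing (multivariateRing rawRing r) in
    IsCommutativeRing M._≈_ M._+_ M._*_ M.-_ M.0# M.1#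
  multivariateCommutativeRing r = record { isCommutativeRing = isCommutativeRing-multivariate r }
  isCommutativeRing-multivariate zero    = isCommutativeRing
  isCommutativeRing-multivariate (suc r) =
    PolynomialProperties.isCommutativeRing-polynomial (multivariateCommutativeRing r)

  -- The coefficients in the first variable are polynomials in the others. Their evaluation at `xs`
  -- is the coefficient homomorphism of the evaluation at `x`.
  eval-isRingHomomorphism : ∀ {r} (xs : Vec Carrier r) →
    IsRingHomomorphism (multivariateRing rawRing r) rawRing (λ F → eval F xs)
  eval-isRingHomomorphism []       = IdentityMorphism.isRingHomomorphism rawRing refl
  eval-isRingHomomorphism {suc r} (x ∷ xs) = PolynomialEvaluation.evaluate-isRingHomomorphism
    (multivariateCommutativeRing r) R (eval-isRingHomomorphism xs) x

  private
    module Evaluation {r : ℕ} (xs : Vec Carrier r) =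
      PolynomialEvaluation (multivariateCommutativeRing r) R (eval-isRingHomomorphism xs)

  const-cong : ∀ r {x y} → x ≈ y → RawRing._≈_ (multivariateRing rawRing r) (const {r} x) (const {r} y)
  const-cong zero    x≈y = x≈y
  const-cong (suc r) x≈y zero    = const-cong r x≈y
  const-cong (suc r) x≈y (suc n) = CommutativeRing.refl (multivariateCommutativeRing r)

  eval-const : ∀ {r} x (xs : Vec Carrier r) → eval (const {r} x) xs ≈ x
  eval-const x []       = refl
  eval-const x (y ∷ xs) = trans
    (Evaluation.evaluate-constant xs y _) (eval-const x xs)

  eval-var : ∀ {r} (i : Fin r) (xs : Vec Carrier r) → eval (var i) xs ≈ lookup xs i
  eval-var zero    (x ∷ xs) = Evaluation.evaluate-variable xs x
  eval-var (suc i) (x ∷ xs) = trans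
    (Evaluation.evaluate-constant xs x _) (eval-var i xs)

  module _ (a : ℕ → Carrier) {r : ℕ} where
    open Newton R a
    private
      module M where
        open RawRing (multivariateRing rawRing r) public
        open RawRingOps (multivariateRing rawRing r) public

    newtonMonomial : Vec ℕ r → M.Carrier
    newtonMonomial ks =
      M.product λ i → M.product {lookup ks i} λ j → var i M.- const {r} (a (toℕ j))

    eval-newtonMonomial : ∀ ks xs → eval (newtonMonomial ks) xs ≈ fallings ks xs
    eval-newtonMonomial ks xs = begin
      eval (newtonMonomial ks) xs
        ≈⟨ product-homo r _ ⟩
      product (λ i → eval (M.product {lookup ks i} λ j → var i M.- const {r} (a (toℕ j))) xs)
        ≈⟨ product-cong r (λ i → factor i (lookup ks i)) ⟩
      product (λ i → falling (lookup ks i) (lookup xs i))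
        ≈⟨ product-falling ks xs ⟩
      fallings ks xs ∎
      where
      open RingHomomorphism (multivariateRing rawRing r) R (eval-isRingHomomorphism xs)
      open IsRingHomomorphism (eval-isRingHomomorphism xs) using (+-homo; -‿homo)

      product-cong : ∀ n {f h : Fin n → Carrier} → (∀ i → f i ≈ h i) → product f ≈ product h
      product-cong zero    e = refl
      product-cong (suc n) e = *-cong (e zero) (product-cong n (e ∘ suc))

      product-falling : ∀ {n} (ks : Vec ℕ n) xs →
        product (λ i → falling (lookup ks i) (lookup xs i)) ≈ fallings ks xs
      product-falling []       []       = refl
      product-falling (k ∷ ks) (x ∷ xs) = *-congˡ (product-falling ks xs)

      factor : ∀ i k → eval (M.product {k} λ j → var i M.- const {r} (a (toℕ j))) xs
                       ≈ falling k (lookup xs i)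
      factor i k = begin
        eval (M.product {k} λ j → var i M.- const {r} (a (toℕ j))) xs
          ≈⟨ product-homo k _ ⟩
        product {k} (λ j → eval (var i M.- const {r} (a (toℕ j))) xs)
          ≈⟨ product-cong k (λ j → trans (+-homo _ _) (+-cong (eval-var i xs)
               (trans (-‿homo _) (-‿cong (eval-const (a (toℕ j)) xs))))) ⟩
        product {k} (λ j → lookup xs i - a (toℕ j))
          ≡⟨ product-toℕ k _ ⟩
        falling k (lookup xs i) ∎

    eval-newtonSum : ∀ (ms : Vec ℕ r) (b : Vec ℕ r → Carrier) (xs : Vec Carrier r) →
      eval {r} (M.sumOver (multiIndices ms) λ ks → const {r} (b ks) M.* newtonMonomial ks) xs
        ≈ boxSum ms λ ks → b ks * fallings ks xs
    eval-newtonSum ms b xs = begin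
      eval {r} (M.sumOver (multiIndices ms) λ ks → const {r} (b ks) M.* newtonMonomial ks) xs
        ≈⟨ sumOver-homo (multiIndices ms) _ ⟩
      sumOver (multiIndices ms) (λ ks → eval (const {r} (b ks) M.* newtonMonomial ks) xs)
        ≈⟨ sumOver-multiIndices ms _ ⟩
      boxSum ms (λ ks → eval (const {r} (b ks) M.* newtonMonomial ks) xs)
        ≈⟨ boxSum-cong {ms = ms} (λ ks _ → trans (*-homo _ _)
             (*-cong (eval-const (b ks) xs) (eval-newtonMonomial ks xs))) ⟩
      boxSum ms (λ ks → b ks * fallings ks xs) ∎
      where
      open RingHomomorphism (multivariateRing rawRing r) R (eval-isRingHomomorphism xs)
      open IsRingHomomorphism (eval-isRingHomomorphism xs) using (*-homo)

-- Factoring a polynomial with as many roots as its degree.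

module Roots {c ℓ} (R : CommutativeRing c ℓ) where
  open CommutativeRing R hiding (zero)
  open IntegerSolver R
  open Exp commutativeSemiring using (_^_)
  open RawRingOps rawRing using (product)
  open SetoidReasoning setoid
  open RingProperties ring using (x≈y⇒x∙y⁻¹≈ε)

  -- The leading coefficient `l` is kept apart from the lower ones, so the length of the vector is
  -- the degree and division by a linear factor leaves `l` unchanged.
  horner : ∀ {n} → Vec Carrier n → Carrier → Carrier → Carrier
  horner []      l x = l
  horner (y ∷ v) l x = y + x * horner v l x

  private
    -- Synthetic division by x - c: the coefficients of the quotient are the intermediate values of
    -- Horner's rule at c.
    quotient : ∀ {n} → Carrier → Vec Carrier (suc n) → Carrier → Vec Carrier n
    quotient c (y ∷ [])    l = []
    quotient c (y ∷ z ∷ v) l = horner (z ∷ v) l c ∷ quotient c (z ∷ v) l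

    horner-quotient : ∀ {n} (v : Vec Carrier (suc n)) l c x →
      horner v l x ≈ horner v l c + (x - c) * horner (quotient c v l) l x
    horner-quotient (y ∷ [])    l c x =
      solve 4 (λ y l c x → y :+ x :* l := y :+ c :* l :+ (x :- c) :* l) refl y l c x
    horner-quotient (y ∷ z ∷ v) l c x = begin
      y + x * horner (z ∷ v) l x
        ≈⟨ +-congˡ (*-congˡ (horner-quotient (z ∷ v) l c x)) ⟩
      y + x * (horner (z ∷ v) l c + (x - c) * horner (quotient c (z ∷ v) l) l x)
        ≈⟨ solve 5 (λ y x c h k → y :+ x :* (h :+ (x :- c) :* k)
                     := (y :+ c :* h) :+ (x :- c) :* (h :+ x :* k)) refl y x c _ _ ⟩
      horner (y ∷ z ∷ v) l c + (x - c) * horner (quotient c (y ∷ z ∷ v) l) l x ∎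

  -- Each root is split off by division. The quotient still vanishes at the other roots, because
  -- differences of roots can be cancelled; in the application these are nonzero constants. After n
  -- divisions only the leading coefficient is left.
  factor : ∀ {n} (v : Vec Carrier n) l (roots : Fin n → Carrier) →
    (∀ {i j} → i ≢ j → ∀ y → (roots j - roots i) * y ≈ 0# → y ≈ 0#) →
    (∀ i → horner v l (roots i) ≈ 0#) →
    ∀ x → horner v l x ≈ l * product λ i → x - roots i
  factor {zero}  []      l roots cancel vanish x = sym (*-identityʳ l)
  factor {suc n} (y ∷ v) l roots cancel vanish x = begin
    horner (y ∷ v) l x
      ≈⟨ divided x ⟩
    (x - roots zero) * horner w l x
      ≈⟨ *-congˡ (factor w l (roots ∘ suc) (λ i≢j → cancel (i≢j ∘ Fin.suc-injective)) vanish′ x) ⟩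
    (x - roots zero) * (l * product λ i → x - roots (suc i))
      ≈⟨ x∙yz≈y∙xz _ _ _ ⟩
    l * product (λ i → x - roots i) ∎
    where
    open CommutativeSemigroupProperties *-commutativeSemigroup using (x∙yz≈y∙xz)
    w = quotient (roots zero) (y ∷ v) l

    divided : ∀ x → horner (y ∷ v) l x ≈ (x - roots zero) * horner w l x
    divided x = trans (horner-quotient (y ∷ v) l (roots zero) x)
                      (trans (+-congʳ (vanish zero)) (+-identityˡ _))

    vanish′ : ∀ i → horner w l (roots (suc i)) ≈ 0#
    vanish′ i = cancel {zero} {suc i} (λ ()) _ (trans (sym (divided _)) (vanish (suc i)))

  x^n-x : ∀ {n} (roots : Fin n → Carrier) → 1 < n →
    (∀ {i j} → i ≢ j → ∀ y → (roots j - roots i) * y ≈ 0# → y ≈ 0#) →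
    (∀ i → roots i ^ n ≈ roots i) →
    ∀ x → x ^ n - x ≈ product λ i → x - roots i
  x^n-x {suc (suc m)} roots (s≤s (s≤s z≤n)) cancel fixed x = begin
    x ^ suc (suc m) - x           ≈⟨ horner-x^n-x x ⟨
    horner v 1# x                 ≈⟨ factor v 1# roots cancel vanish x ⟩
    1# * product (λ i → x - roots i)  ≈⟨ *-identityˡ _ ⟩
    product (λ i → x - roots i)       ∎
    where
    -- The coefficients of X^(m+2) - X below its leading 1. The assumption 1 < n keeps the linear
    -- term below the leading one.
    v = 0# ∷ - 1# ∷ Vec.replicate m 0#

    horner-x^ : ∀ m x → horner (Vec.replicate m 0#) 1# x ≈ x ^ m
    horner-x^ zero    x = refl
    horner-x^ (suc m) x = trans (+-identityˡ _) (*-congˡ (horner-x^ m x))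

    horner-x^n-x : ∀ x → horner v 1# x ≈ x ^ suc (suc m) - x
    horner-x^n-x x = begin
      0# + x * (- 1# + x * horner (Vec.replicate m 0#) 1# x)
        ≈⟨ +-identityˡ _ ⟩
      x * (- 1# + x * horner (Vec.replicate m 0#) 1# x)
        ≈⟨ *-congˡ (+-congˡ (*-congˡ (horner-x^ m x))) ⟩
      x * (- 1# + x * x ^ m)
        ≈⟨ solve 3 (λ x y o → x :* (:- o :+ x :* y) := x :* (x :* y) :- x :* o) refl x _ 1# ⟩
      x ^ suc (suc m) - x * 1#
        ≈⟨ +-congˡ (-‿cong (*-identityʳ x)) ⟩
      x ^ suc (suc m) - x ∎

    vanish : ∀ i → horner v 1# (roots i) ≈ 0#
    vanish i = trans (horner-x^n-x (roots i)) (x≈y⇒x∙y⁻¹≈ε (fixed i))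

-- Inverses and Fermat's theorem in the finite field.

module FiniteFieldProperties {c ℓ₁ ℓ₂} (𝔽 : FiniteField c ℓ₁ ℓ₂) where
  open FiniteField 𝔽 using (q; 1<q; enumeration; enumeration-zero; _≈?_; #⇒invertible; tight)
  open CommutativeRing (FiniteField.commutativeRing 𝔽) hiding (zero)
  open RingProperties ring
  open Exp commutativeSemiring using (_^_)
  open SetoidReasoning setoid
  open CommutativeMonoidSum *-commutativeMonoid using () renaming
    (sum to product; sum-cong-≋ to product-cong; ∑-distrib-+ to product-distrib-*;
     sum-permute to product-permute; sum-replicate to product-replicate)

  open Inverse enumeration public using (to; from)

  to-from : ∀ x → to (from x) ≈ x
  to-from x = Inverse.inverseˡ enumeration ≡.refl

  from-to : ∀ i → from (to i) ≡ i
  from-to i = Inverse.inverseʳ enumeration refl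

  from-cong : ∀ {x y} → x ≈ y → from x ≡ from y
  from-cong = Inverse.from-cong enumeration

  to-injective : ∀ {i j} → to i ≈ to j → i ≡ j
  to-injective {i} {j} e = ≡.trans (≡.sym (from-to i)) (≡.trans (from-cong e) (from-to j))

  -- Tightness only yields the double negation of an inverse, but an inverse
  -- can be searched for.
  inverse : ∀ {x} → x ≉ 0# → ∃ λ y → y * x ≈ 1#
  inverse {x} x≉0 with Fin.any? (λ i → (to i * x) ≈? 1#)
  ... | yes (i , e) = to i , e
  ... | no  none    = contradiction (proj₁ (tight x 0#) notApart) x≉0
    where
    notApart : ¬ FiniteField._#_ 𝔽 x 0#
    notApart x#0 with #⇒invertible x#0
    ... | y , y[x-0]≈1 , _ = none (from y , (begin
      to (from y) * x  ≈⟨ *-cong (to-from y) (sym (trans (+-congˡ -0#≈0#) (+-identityʳ x))) ⟩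
      y * (x - 0#)     ≈⟨ y[x-0]≈1 ⟩
      1#               ∎))

  1≉0 : 1# ≉ 0#
  1≉0 1≈0 = contradiction (to-injective all-equal) λ 0≡1 → ℕ.<⇒≢ ℕ.z<s
    (≡.trans (≡.sym (Fin.toℕ-fromℕ< 0<q)) (≡.trans (≡.cong toℕ 0≡1) (Fin.toℕ-fromℕ< 1<q)))
    where
    0<q = ℕ.<-trans (ℕ.n<1+n 0) 1<q

    x≈0 : ∀ x → x ≈ 0#
    x≈0 x = trans (sym (*-identityˡ x)) (trans (*-congʳ 1≈0) (zeroˡ x))

    all-equal : to (Fin.fromℕ< 0<q) ≈ to (Fin.fromℕ< 1<q)
    all-equal = trans (x≈0 _) (sym (x≈0 _))

  *-cancel-0 : ∀ {x y} → x ≉ 0# → x * y ≈ 0# → y ≈ 0#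
  *-cancel-0 {x} {y} x≉0 xy≈0 with inverse x≉0
  ... | z , zx≈1 = begin
    y            ≈⟨ *-identityˡ y ⟨
    1# * y       ≈⟨ *-congʳ zx≈1 ⟨
    z * x * y    ≈⟨ *-assoc z x y ⟩
    z * (x * y)  ≈⟨ *-congˡ xy≈0 ⟩
    z * 0#       ≈⟨ zeroʳ z ⟩
    0#           ∎

  module _ {n : ℕ} (en : Fin (suc n) → Carrier) (index : Carrier → Fin (suc n))
    (en-index : ∀ x → en (index x) ≈ x) (en-injective : ∀ {i j} → en i ≈ en j → i ≡ j)
    (en-zero : en zero ≈ 0#) where

    private
      -- Zero is replaced by 1, so that the product of the nonzero elements runs over all of
      -- `Fin (suc n)`, on which multiplication by a nonzero x is a permutation.
      orOne : ∀ {x} → Dec (x ≈ 0#) → Carrier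
      orOne         (yes _) = 1#
      orOne {x = x} (no _)  = x

      orOne≉0 : ∀ {x} (d : Dec (x ≈ 0#)) → orOne d ≉ 0#
      orOne≉0 (yes _)   = 1≉0
      orOne≉0 (no x≉0) = x≉0

      product≉0 : ∀ {m} (f : Fin m → Carrier) → (∀ i → f i ≉ 0#) → product f ≉ 0#
      product≉0 {zero}  f f≉0 = 1≉0
      product≉0 {suc m} f f≉0 = product≉0 (f ∘ suc) (f≉0 ∘ suc) ∘ *-cancel-0 (f≉0 zero)

    -- Multiplication by x permutes the nonzero elements, so xⁿ times their
    -- product is their product.
    x^n≈1 : ∀ {x} → x ≉ 0# → x ^ n ≈ 1#
    x^n≈1 {x} x≉0 with inverse x≉0
    ... | y , yx≈1 = begin
      x ^ n                      ≈⟨ product-replicate n ⟨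
      product (λ (_ : Fin n) → x)
                                 ≈⟨ *-identityˡ _ ⟨
      product factors            ≈⟨ x∙y⁻¹≈ε⇒x≈y _ _ (*-cancel-0 (product≉0 units (λ i → orOne≉0 (en i ≈? 0#))) cancelled) ⟩
      1#                         ∎
      where
      units factors : Fin (suc n) → Carrier
      units i = orOne (en i ≈? 0#)
      -- Index 0 is the zero element, which multiplication by x fixes and which counts as 1 in
      -- `units`. Hence the total factor is x^n and not x^(n+1).
      factors zero    = 1#
      factors (suc i) = x

      mul-inverse : ∀ {x y} → y * x ≈ 1# → ∀ i → index (x * en (index (y * en i))) ≡ i
      mul-inverse {x} {y} yx≈1 i = en-injective (begin
        en (index (x * en (index (y * en i))))  ≈⟨ en-index _ ⟩
        x * en (index (y * en i))               ≈⟨ *-congˡ (en-index _) ⟩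
        x * (y * en i)                          ≈⟨ *-assoc _ _ _ ⟨
        x * y * en i                            ≈⟨ *-congʳ (trans (*-comm x y) yx≈1) ⟩
        1# * en i                               ≈⟨ *-identityˡ _ ⟩
        en i                                    ∎)

      π : Permutation (suc n) (suc n)
      π = permutation (λ i → index (x * en i)) (λ i → index (y * en i))
            (mul-inverse yx≈1) (mul-inverse (trans (*-comm x y) yx≈1))

      units-π : ∀ i → units (π ⟨$⟩ʳ i) ≈ factors i * units i
      units-π zero with en (index (x * en zero)) ≈? 0# | en zero ≈? 0#
      ... | yes _ | yes _ = sym (*-identityˡ 1#)
      ... | _     | no ≉0 = contradiction en-zero ≉0
      ... | no ≉0 | yes _ =
        contradiction (trans (en-index _) (trans (*-congˡ en-zero) (zeroʳ x))) ≉0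
      units-π (suc i) with en (index (x * en (suc i))) ≈? 0# | en (suc i) ≈? 0#
      ... | yes ≈0 | no ≉0 = contradiction (*-cancel-0 x≉0 (trans (sym (en-index _)) ≈0)) ≉0
      ... | no _   | no _  = en-index _
      ... | _      | yes ≈0 = contradiction (en-injective (trans ≈0 (sym en-zero))) λ ()

      cancelled : product units * (product factors - 1#) ≈ 0#
      cancelled = begin
        product units * (product factors - 1#)
          ≈⟨ distribˡ _ _ _ ⟩
        product units * product factors + product units * - 1#
          ≈⟨ +-cong (*-comm _ _) (sym (-‿distribʳ-* _ _)) ⟩
        product factors * product units - product units * 1#
          ≈⟨ +-cong (sym (product-distrib-* factors units)) (-‿cong (*-identityʳ _)) ⟩
        product (λ i → factors i * units i) - product units
          ≈⟨ +-congʳ (product-cong units-π) ⟨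
        product (λ i → units (π ⟨$⟩ʳ i)) - product units
          ≈⟨ +-congʳ (product-permute units π) ⟨
        product units - product units
          ≈⟨ -‿inverseʳ _ ⟩
        0# ∎

    x^[1+n]≈x : ∀ x → x ^ suc n ≈ x
    x^[1+n]≈x x with x ≈? 0#
    ... | yes x≈0 = trans (*-congʳ x≈0) (trans (zeroˡ _) (sym x≈0))
    ... | no  x≉0 = trans (*-congˡ (x^n≈1 x≉0)) (*-identityʳ x)

  -- q is a field of a record, so it has to be generalised to be split.
  x^q≈x : ∀ x → x ^ q ≈ x
  x^q≈x = go q to from to-from to-injective enumeration-zero
    where
    go : ∀ n (en : Fin n → Carrier) (index : Carrier → Fin n) →
      (∀ x → en (index x) ≈ x) → (∀ {i j} → en i ≈ en j → i ≡ j) →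
      (∀ i → toℕ i ≡ 0 → en i ≈ 0#) → ∀ x → x ^ n ≈ x
    go zero    en index _        _            _       x = contradiction (index x) λ ()
    go (suc n) en index en-index en-injective en-zero x =
      x^[1+n]≈x en index en-index en-injective (en-zero zero ≡.refl) x

-- Base-q digits and the enumeration of the polynomials.

module Digits {c ℓ₁ ℓ₂} (𝔽 : FiniteField c ℓ₁ ℓ₂) where
  open FiniteField 𝔽 using (q; 1<q; enumeration-zero)
  open FiniteFieldProperties 𝔽
  open CommutativeRing (FiniteField.commutativeRing 𝔽) hiding (zero)
  open Polynomial rawRing hiding (polynomialRing)
  open PolynomialProperties (FiniteField.commutativeRing 𝔽) using (coeff-add)
  open OverFiniteField 𝔽 using (a)

  infix 4 _≋_
  _≋_ : List Carrier → List Carrier → Set ℓ₁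
  p ≋ p′ = ∀ n → coeff p n ≈ coeff p′ n

  instance
    q-nonZero : NonZero q
    q-nonZero = ℕ.>-nonZero (ℕ.<-trans ℕ.z<s 1<q)

  private
    digit : ℕ → Fin q
    digit n = Fin.fromℕ< (ℕ.m%n<n n q)

    digit+quotient : ∀ n → toℕ (digit n) ℕ.+ n / q ℕ.* q ≡ n
    digit+quotient n = ≡.trans
      (≡.cong (ℕ._+ n / q ℕ.* q) (Fin.toℕ-fromℕ< (ℕ.m%n<n n q))) (≡.sym (ℕ.m≡m%n+[m/n]*n n q))

    head-digit : ∀ (d : Fin q) k → (toℕ d ℕ.+ k ℕ.* q) % q ≡ toℕ d
    head-digit d k = ≡.trans (ℕ.[m+kn]%n≡m%n (toℕ d) k q) (ℕ.m<n⇒m%n≡m (Fin.toℕ<n d))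

    digits-injective : ∀ (d e : Fin q) k l →
      toℕ d ℕ.+ k ℕ.* q ≡ toℕ e ℕ.+ l ℕ.* q → d ≡ e × k ≡ l
    digits-injective d e k l eq = Fin.toℕ-injective d≡e ,
      ℕ.*-cancelʳ-≡ k l q (ℕ.+-cancelˡ-≡ (toℕ d) _ _
        (≡.trans eq (≡.cong (ℕ._+ l ℕ.* q) (≡.sym d≡e))))
      where
      d≡e : toℕ d ≡ toℕ e
      d≡e = ≡.trans (≡.sym (head-digit d k)) (≡.trans (≡.cong (_% q) eq) (head-digit e l))

    fromDigits-zero : ∀ (ds : List (Fin q)) → fromDigits ds ≡ 0 → map to ds ≋ []
    fromDigits-zero []       eq n       = refl
    fromDigits-zero (d ∷ ds) eq zero    = enumeration-zero d (ℕ.m+n≡0⇒m≡0 (toℕ d) eq)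
    fromDigits-zero (d ∷ ds) eq (suc n) =
      fromDigits-zero ds (ℕ.m*n≡0⇒m≡0 _ q (ℕ.m+n≡0⇒n≡0 (toℕ d) eq)) n

    -- The expansions agree up to leading zeros, and zero is the digit 0.
    fromDigits-injective : ∀ (ds es : List (Fin q)) →
      fromDigits ds ≡ fromDigits es → map to ds ≋ map to es
    fromDigits-injective []       es       eq n = sym (fromDigits-zero es (≡.sym eq) n)
    fromDigits-injective (d ∷ ds) []       eq n = fromDigits-zero (d ∷ ds) eq n
    fromDigits-injective (d ∷ ds) (e ∷ es) eq n
      with digits-injective d e (fromDigits ds) (fromDigits es) eq
    fromDigits-injective (d ∷ ds) (e ∷ es) eq zero    | ≡.refl , _ = refl
    fromDigits-injective (d ∷ ds) (e ∷ es) eq (suc n) | _ , eq′ = fromDigits-injective ds es eq′ n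

    expansion : ∀ k → ∃ λ (ds : List (Fin q)) → fromDigits ds ≡ k
    expansion = toDigits q {fromWitness 1<q}

  a-zero : a 0 ≋ []
  a-zero = fromDigits-zero (proj₁ (expansion 0)) (proj₂ (expansion 0))

  -- By `fromDigits-injective` only the value of a digit string matters, so d followed by the digits
  -- of k may stand for whatever `toDigits` returns on d + k q.
  a-∷ : ∀ d k → a (toℕ d ℕ.+ k ℕ.* q) ≋ to d ∷ a k
  a-∷ d k = fromDigits-injective (proj₁ (expansion _)) (d ∷ proj₁ (expansion k))
    (≡.trans (proj₂ (expansion _)) (≡.cong (λ l → toℕ d ℕ.+ l ℕ.* q) (≡.sym (proj₂ (expansion k)))))

  a-digit : ∀ k → a k ≋ to (digit k) ∷ a (k / q)
  a-digit k = ≡.subst (λ l → a l ≋ to (digit k) ∷ a (k / q)) (digit+quotient k) (a-∷ (digit k) (k / q))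

  a-constant : ∀ d → a (toℕ d) ≋ to d ∷ []
  a-constant d n = trans
    (reflexive (≡.cong (λ k → coeff (a k) n) (≡.sym (ℕ.+-identityʳ (toℕ d)))))
    (trans (a-∷ d 0 n) (tail n))
    where
    tail : to d ∷ a 0 ≋ to d ∷ []
    tail zero    = refl
    tail (suc n) = a-zero n

  -- A coefficientwise form of deg p < d: it includes the zero polynomial for every d, and sums and
  -- tails need no case distinction.
  Below : ℕ → List Carrier → Set ℓ₁
  Below d p = ∀ n → d ≤ n → coeff p n ≈ 0#

  private
    /-< : ∀ {k} d → k < q ℕ.^ suc d → k / q < q ℕ.^ d
    /-< {k} d k< = ℕ.m<n*o⇒m/o<n (ℕ.<-≤-trans k< (ℕ.≤-reflexive (ℕ.*-comm q (q ℕ.^ d))))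

  a-below : ∀ d {k} → k < q ℕ.^ d → Below d (a k)
  a-below zero    {zero}  _        n       _         = a-zero n
  a-below zero    {suc k} (s≤s ())
  a-below (suc d) {k}     k<       (suc n) (s≤s d≤n) =
    trans (a-digit k (suc n)) (a-below d (/-< d k<) n d≤n)

  a-surjective : ∀ d p → Below d p → ∃ λ k → k < q ℕ.^ d × p ≋ a k
  a-surjective d       []      below = 0 , ℕ.m^n>0 q d , sym ∘ a-zero
  a-surjective zero    p       below = 0 , ℕ.z<s , λ n → trans (below n z≤n) (sym (a-zero n))
  a-surjective (suc d) (x ∷ p) below with a-surjective d p (λ n d≤n → below (suc n) (s≤s d≤n))
  ... | k , k< , p≋aₖ = toℕ (from x) ℕ.+ k ℕ.* q , bound , equal
    where
    bound : toℕ (from x) ℕ.+ k ℕ.* q < q ℕ.^ suc d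
    bound = begin-strict
      toℕ (from x) ℕ.+ k ℕ.* q  <⟨ ℕ.+-monoˡ-< (k ℕ.* q) (Fin.toℕ<n (from x)) ⟩
      suc k ℕ.* q               ≤⟨ ℕ.*-monoˡ-≤ q k< ⟩
      q ℕ.^ d ℕ.* q             ≡⟨ ℕ.*-comm (q ℕ.^ d) q ⟩
      q ℕ.^ suc d               ∎
      where open ℕ.≤-Reasoning

    equal : x ∷ p ≋ a (toℕ (from x) ℕ.+ k ℕ.* q)
    equal zero    = trans (sym (to-from x)) (sym (a-∷ (from x) k 0))
    equal (suc n) = trans (p≋aₖ n) (sym (a-∷ (from x) k (suc n)))

  monomial : Carrier → ℕ → List Carrier
  monomial x zero    = x ∷ []
  monomial x (suc h) = 0# ∷ monomial x h

  -- As j occupies only the places below h, the digit d at place h adds the single term a_d t^h.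
  -- Blocks of indices thereby become translates of the initial block.
  a-split : ∀ h d {j} → j < q ℕ.^ h →
    a (toℕ d ℕ.* q ℕ.^ h ℕ.+ j) ≋ add (monomial (to d) h) (a j)
  a-split zero    d {zero}  _        n = trans
    (reflexive (≡.cong (λ k → coeff (a k) n) (≡.trans (ℕ.+-identityʳ _) (ℕ.*-identityʳ (toℕ d)))))
    (trans (a-constant d n)
      (trans (sym (+-identityʳ _))
        (trans (+-congˡ (sym (a-zero n))) (sym (coeff-add (monomial (to d) 0) (a 0) n)))))
  a-split zero    d {suc j} (s≤s ())
  a-split (suc h) d {j}     j<       n = trans
    (reflexive (≡.cong (λ k → coeff (a k) n) (≡.sym regroup)))
    (trans (a-∷ (digit j) k n)
      (trans (digitwise n)
        (trans (+-congˡ (sym (a-digit j n))) (sym (coeff-add (monomial (to d) (suc h)) (a j) n)))))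
    where
    k = toℕ d ℕ.* q ℕ.^ h ℕ.+ j / q

    regroup : toℕ (digit j) ℕ.+ k ℕ.* q ≡ toℕ d ℕ.* q ℕ.^ suc h ℕ.+ j
    regroup = ≡.trans (identity (toℕ (digit j)) (toℕ d) (q ℕ.^ h) (j / q) q)
                      (≡.cong (toℕ d ℕ.* q ℕ.^ suc h ℕ.+_) (digit+quotient j))
      where
      identity : ∀ r d Q s q → r ℕ.+ (d ℕ.* Q ℕ.+ s) ℕ.* q ≡ d ℕ.* (q ℕ.* Q) ℕ.+ (r ℕ.+ s ℕ.* q)
      identity = solve-∀

    digitwise : ∀ n → coeff (to (digit j) ∷ a k) n ≈
      coeff (monomial (to d) (suc h)) n + coeff (to (digit j) ∷ a (j / q)) n
    digitwise zero    = sym (+-identityˡ _)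
    digitwise (suc n) = trans (a-split h d (/-< h j<) n) (coeff-add (monomial (to d) h) (a (j / q)) n)

-- Carlitz's theorem: k! divides every value of (x)ₖ.

module Carlitz {c ℓ₁ ℓ₂} (𝔽 : FiniteField c ℓ₁ ℓ₂) {c′ ℓ} (R : CommutativeRing c′ ℓ)
  {C : FiniteField.Carrier 𝔽 → CommutativeRing.Carrier R}
  (C-hom : IsRingHomomorphism (FiniteField.rawRing 𝔽) (CommutativeRing.rawRing R) C)
  (t : CommutativeRing.Carrier R)
  (generated : ∀ x → ∃ λ p → CommutativeRing._≈_ R x
    (PolynomialEvaluation.evaluate (FiniteField.commutativeRing 𝔽) R C-hom t p)) where

  private
    module K = CommutativeRing (FiniteField.commutativeRing 𝔽)
    module KExp = Exp K.commutativeSemiring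
    module C = IsRingHomomorphism C-hom
  open FiniteField 𝔽 using (q; 1<q)
  open FiniteFieldProperties 𝔽
  open Digits 𝔽
  open OverFiniteField 𝔽 using (a)
  open CommutativeRing R hiding (zero)
  open Polynomial K.rawRing using (coeff; add)
  open RingProperties ring using (-0#≈0#)
  open Exp commutativeSemiring using (_^_; ^-congˡ; ^-congʳ; ^-assocʳ; ^-distrib-*)
  open CommutativeSemigroupProperties *-commutativeSemigroup using (interchange)
  open CommutativeMonoidSum *-commutativeMonoid using () renaming
    (sum to product; sum-cong-≋ to product-cong; sum-permute to product-permute)
  open BigOperators R
  open RawRingOps rawRing using (_∣_)
  open import Algebra.Definitions.RawMagma *-rawMagma using (_,_)
  open IntegerSolver R
  open SetoidReasoning setoid

  private
    module Evaluate = PolynomialEvaluation (FiniteField.commutativeRing 𝔽) R C-hom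

  open Evaluate t public using () renaming (evaluate to ⟦_⟧)
  private
    module ⟦⟧ = IsRingHomomorphism (Evaluate.evaluate-isRingHomomorphism t)

  open Newton R (λ k → ⟦ a k ⟧) using (falling; falling-cong)

  private
    ^q-zero : ∀ {x} → x ≈ 0# → x ^ q ≈ 0#
    ^q-zero {x} x≈0 = begin
      x ^ q              ≡⟨ ≡.cong (x ^_) (≡.sym (ℕ.suc-pred q)) ⟩
      x * x ^ ℕ.pred q   ≈⟨ *-congʳ x≈0 ⟩
      0# * x ^ ℕ.pred q  ≈⟨ zeroˡ _ ⟩
      0#                 ∎

    C-^ : ∀ x n → C (x KExp.^ n) ≈ C x ^ n
    C-^ x zero    = C.1#-homo
    C-^ x (suc n) = trans (C.*-homo x _) (*-congˡ (C-^ x n))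

    C^q : ∀ x → C x ^ q ≈ C x
    C^q x = trans (sym (C-^ x q)) (C.⟦⟧-cong (x^q≈x x))

    C-difference : ∀ x y → C (x K.- y) ≈ C x - C y
    C-difference x y = trans (C.+-homo x _) (+-congˡ (C.-‿homo y))

    C-invertible : ∀ {x y} → ¬ x K.≈ y → ∃ λ z → z * (C x - C y) ≈ 1#
    C-invertible {x} {y} x≉y
      with inverse (λ e → x≉y (RingProperties.x∙y⁻¹≈ε⇒x≈y K.ring x y e))
    ... | z , zd≈1 = C z , (begin
      C z * (C x - C y)    ≈⟨ *-congˡ (C-difference x y) ⟨
      C z * C (x K.- y)    ≈⟨ C.*-homo z _ ⟨
      C (z K.* (x K.- y))  ≈⟨ C.⟦⟧-cong zd≈1 ⟩
      C K.1#               ≈⟨ C.1#-homo ⟩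
      1#                   ∎)

    roots-cancel : ∀ {i j} → i ≢ j → ∀ y → (C (to j) - C (to i)) * y ≈ 0# → y ≈ 0#
    roots-cancel {i} {j} i≢j y e with C-invertible {to j} {to i} (i≢j ∘ ≡.sym ∘ to-injective)
    ... | z , zd≈1 = begin
      y                                ≈⟨ *-identityˡ y ⟨
      1# * y                           ≈⟨ *-congʳ zd≈1 ⟨
      z * (C (to j) - C (to i)) * y    ≈⟨ *-assoc _ _ _ ⟩
      z * ((C (to j) - C (to i)) * y)  ≈⟨ *-congˡ e ⟩
      z * 0#                           ≈⟨ zeroʳ z ⟩
      0#                               ∎

    x^q-x : ∀ x → x ^ q - x ≈ product λ i → x - C (to i)
    x^q-x = Roots.x^n-x R (C ∘ to) 1<q roots-cancel (C^q ∘ to)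

    -- X^q - X = ∏ (X - c) is invariant under translation by constants.
    ^q-translate : ∀ x c → (x + C c) ^ q ≈ x ^ q + C c
    ^q-translate x c = begin
      (x + C c) ^ q
        ≈⟨ solve 3 (λ y x c → y := (y :- (x :+ c)) :+ (x :+ c)) refl _ x (C c) ⟩
      ((x + C c) ^ q - (x + C c)) + (x + C c)
        ≈⟨ +-congʳ translated ⟩
      (x ^ q - x) + (x + C c)
        ≈⟨ solve 3 (λ y x c → (y :- x) :+ (x :+ c) := y :+ c) refl _ x (C c) ⟩
      x ^ q + C c ∎
      where
      shift-inverse : ∀ {d e} → (∀ x → (x K.+ e) K.+ d K.≈ x) →
                      ∀ i → from (to (from (to i K.+ e)) K.+ d) ≡ i
      shift-inverse cancel i = ≡.trans
        (from-cong (K.trans (K.+-congʳ (to-from _)) (cancel (to i)))) (from-to i)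

      π : Permutation q q
      π = permutation (λ i → from (to i K.- c)) (λ i → from (to i K.+ c))
        (shift-inverse λ x → K.trans (K.+-assoc x c _) (K.trans (K.+-congˡ (K.-‿inverseʳ c)) (K.+-identityʳ x)))
        (shift-inverse λ x → K.trans (K.+-assoc x _ c) (K.trans (K.+-congˡ (K.-‿inverseˡ c)) (K.+-identityʳ x)))

      translated : (x + C c) ^ q - (x + C c) ≈ x ^ q - x
      translated = begin
        (x + C c) ^ q - (x + C c)                 ≈⟨ x^q-x (x + C c) ⟩
        product (λ i → x + C c - C (to i))        ≈⟨ product-cong shifted ⟩
        product (λ i → x - C (to (π ⟨$⟩ʳ i)))     ≈⟨ product-permute (λ i → x - C (to i)) π ⟨
        product (λ i → x - C (to i))              ≈⟨ x^q-x x ⟨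
        x ^ q - x                                 ∎
        where
        shifted : ∀ i → x + C c - C (to i) ≈ x - C (to (π ⟨$⟩ʳ i))
        shifted i = begin
          x + C c - C (to i)             ≈⟨ solve 3 (λ x c d → x :+ c :- d := x :- (d :- c)) refl x (C c) _ ⟩
          x - (C (to i) - C c)           ≈⟨ +-congˡ (-‿cong (C-difference (to i) c)) ⟨
          x - C (to i K.- c)             ≈⟨ +-congˡ (-‿cong (C.⟦⟧-cong (to-from _))) ⟨
          x - C (to (π ⟨$⟩ʳ i))          ∎

    -- Hence x ↦ x^q is the substitution t ↦ t^q, which is additive.
    ^q-evaluate : ∀ p → ⟦ p ⟧ ^ q ≈ Evaluate.evaluate (t ^ q) p
    ^q-evaluate []      = ^q-zero refl
    ^q-evaluate (x ∷ p) = begin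
      (C x + t * ⟦ p ⟧) ^ q                       ≈⟨ ^-congˡ q (+-comm _ _) ⟩
      (t * ⟦ p ⟧ + C x) ^ q                       ≈⟨ ^q-translate _ x ⟩
      (t * ⟦ p ⟧) ^ q + C x                       ≈⟨ +-comm _ _ ⟩
      C x + (t * ⟦ p ⟧) ^ q                       ≈⟨ +-congˡ (^-distrib-* t _ q) ⟩
      C x + t ^ q * ⟦ p ⟧ ^ q                     ≈⟨ +-congˡ (*-congˡ (^q-evaluate p)) ⟩
      C x + t ^ q * Evaluate.evaluate (t ^ q) p   ∎

  -- Both arguments are polynomials in t, and on these the q-th power is evaluation at `t ^ q`, a
  -- ring homomorphism. No binomial coefficients enter.
  ^q-+ : ∀ x y → (x + y) ^ q ≈ x ^ q + y ^ q
  ^q-+ x y with generated x | generated y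
  ... | p , x≈p | p′ , y≈p′ = begin
    (x + y) ^ q              ≈⟨ ^-congˡ q (trans (+-cong x≈p y≈p′) (sym (⟦⟧.+-homo p p′))) ⟩
    ⟦ add p p′ ⟧ ^ q         ≈⟨ ^q-evaluate (add p p′) ⟩
    Evaluate.evaluate (t ^ q) (add p p′)
                             ≈⟨ IsRingHomomorphism.+-homo (Evaluate.evaluate-isRingHomomorphism (t ^ q)) p p′ ⟩
    Evaluate.evaluate (t ^ q) p + Evaluate.evaluate (t ^ q) p′
                             ≈⟨ +-cong (^q-evaluate p) (^q-evaluate p′) ⟨
    ⟦ p ⟧ ^ q + ⟦ p′ ⟧ ^ q   ≈⟨ +-cong (^-congˡ q x≈p) (^-congˡ q y≈p′) ⟨
    x ^ q + y ^ q            ∎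

  ^q-difference : ∀ x y → (x - y) ^ q ≈ x ^ q - y ^ q
  ^q-difference x y = begin
    (x - y) ^ q                    ≈⟨ solve 2 (λ u v → u := (u :+ v) :- v) refl _ (y ^ q) ⟩
    ((x - y) ^ q + y ^ q) - y ^ q  ≈⟨ +-congʳ (^q-+ (x - y) y) ⟨
    ((x - y) + y) ^ q - y ^ q      ≈⟨ +-congʳ (^-congˡ q (solve 2 (λ x y → x :- y :+ y := x) refl x y)) ⟩
    x ^ q - y ^ q                  ∎

  -- The Carlitz polynomial E_h, of degree q^h: the quotient of
  -- ∏_{deg m < h} (x - m) by its value D_h at t^h. It is given here by
  -- E_h(t x) = t E_h(x) + E_{h-1}(x)^q, which shows that its values on R are
  -- integral.
  E : ℕ → List K.Carrier → Carrier
  E zero    p       = ⟦ p ⟧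
  E (suc h) []      = 0#
  E (suc h) (x ∷ p) = t * E (suc h) p + E h p ^ q

  E-zero : ∀ h p → (∀ n → coeff p n K.≈ K.0#) → E h p ≈ 0#
  E-zero zero    p       p≈0 = trans (⟦⟧.⟦⟧-cong {p} {[]} p≈0) refl
  E-zero (suc h) []      p≈0 = refl
  E-zero (suc h) (x ∷ p) p≈0 = begin
    t * E (suc h) p + E h p ^ q
      ≈⟨ +-cong (*-congˡ (E-zero (suc h) p (p≈0 ∘ suc))) (^q-zero (E-zero h p (p≈0 ∘ suc))) ⟩
    t * 0# + 0#  ≈⟨ +-identityʳ _ ⟩
    t * 0#       ≈⟨ zeroʳ t ⟩
    0#           ∎

  -- The polynomials of degree < h are the roots of e_h. In the recursion both terms vanish, since
  -- the tail has degree lower by one.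
  E-below : ∀ h p → Below h p → E h p ≈ 0#
  E-below zero    p       below = E-zero 0 p λ n → below n z≤n
  E-below (suc h) []      below = refl
  E-below (suc h) (x ∷ p) below = begin
    t * E (suc h) p + E h p ^ q
      ≈⟨ +-cong (*-congˡ (E-below (suc h) p λ n h<n → below′ n (ℕ.<⇒≤ h<n)))
                (^q-zero (E-below h p below′)) ⟩
    t * 0# + 0#  ≈⟨ +-identityʳ _ ⟩
    t * 0#       ≈⟨ zeroʳ t ⟩
    0#           ∎
    where
    below′ : Below h p
    below′ n h≤n = below (suc n) (s≤s h≤n)

  E-cong : ∀ h {p p′} → p ≋ p′ → E h p ≈ E h p′
  E-cong zero    {p}     {p′}      p≋p′ = ⟦⟧.⟦⟧-cong {p} {p′} p≋p′
  E-cong (suc h) {[]}    {p′}      p≋p′ = sym (E-zero (suc h) p′ (K.sym ∘ p≋p′))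
  E-cong (suc h) {x ∷ p} {[]}      p≋p′ = E-zero (suc h) (x ∷ p) p≋p′
  E-cong (suc h) {x ∷ p} {x′ ∷ p′} p≋p′ =
    +-cong (*-congˡ (E-cong (suc h) {p} {p′} (p≋p′ ∘ suc))) (^-congˡ q (E-cong h {p} {p′} (p≋p′ ∘ suc)))

  E-add : ∀ h p p′ → E h (add p p′) ≈ E h p + E h p′
  E-add zero    p       p′        = ⟦⟧.+-homo p p′
  E-add (suc h) []      p′        = sym (+-identityˡ _)
  E-add (suc h) (x ∷ p) []        = sym (+-identityʳ _)
  E-add (suc h) (x ∷ p) (x′ ∷ p′) = begin
    t * E (suc h) (add p p′) + E h (add p p′) ^ q
      ≈⟨ +-cong (*-congˡ (E-add (suc h) p p′)) (trans (^-congˡ q (E-add h p p′)) (^q-+ _ _)) ⟩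
    t * (E (suc h) p + E (suc h) p′) + (E h p ^ q + E h p′ ^ q)
      ≈⟨ solve 5 (λ t x y u v → t :* (x :+ y) :+ (u :+ v) := (t :* x :+ u) :+ (t :* y :+ v))
           refl t _ _ _ _ ⟩
    (t * E (suc h) p + E h p ^ q) + (t * E (suc h) p′ + E h p′ ^ q) ∎

  monomial-below : ∀ x h → Below (suc h) (monomial x h)
  monomial-below x zero    (suc n) (s≤s _)   = K.refl
  monomial-below x (suc h) (suc n) (s≤s h<n) = monomial-below x h n h<n

  -- The normalisation E_h(t^h) = 1, with a constant factor, which the q-th power fixes. The other
  -- term of the recursion vanishes because the tail has too small a degree.
  E-monomial : ∀ x h → E h (monomial x h) ≈ C x
  E-monomial x zero    = Evaluate.evaluate-constant t x
  E-monomial x (suc h) = begin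
    t * E (suc h) (monomial x h) + E h (monomial x h) ^ q
      ≈⟨ +-cong (*-congˡ (E-below (suc h) (monomial x h) (monomial-below x h)))
                (trans (^-congˡ q (E-monomial x h)) (C^q x)) ⟩
    t * 0# + C x  ≈⟨ +-congʳ (zeroʳ t) ⟩
    0# + C x      ≈⟨ +-identityˡ _ ⟩
    C x           ∎

  -- Carlitz's [h]. It yields his D_h, for R = A the product of the monic polynomials of degree h,
  -- through D_h = [h] D_{h-1}^q.
  bracket : ℕ → Carrier
  bracket h = t ^ (q ℕ.^ h) - t

  private
    t^q^[1+h] : ∀ h → (t ^ (q ℕ.^ h)) ^ q ≈ t ^ (q ℕ.^ suc h)
    t^q^[1+h] h = trans (^-assocʳ t (q ℕ.^ h) q) (^-congʳ t (ℕ.*-comm (q ℕ.^ h) q))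

  -- Carlitz's relation, which identifies the E_{h+1} of the recursion with the quotient of E_h^q -
  -- E_h = ∏ (E_h - c) by [h+1]. The induction uses the relation at (h+1, p) for the first term of
  -- the recursion and the q-th power of the relation at (h, p) for the second; for h = 0,
  -- translation by a constant takes the place of the latter.
  bracket-E : ∀ h p → bracket (suc h) * E (suc h) p ≈ E h p ^ q - E h p
  bracket-E h       []      = begin
    bracket (suc h) * 0#    ≈⟨ zeroʳ _ ⟩
    0#                      ≈⟨ -‿inverseʳ 0# ⟨
    0# - 0#                 ≈⟨ +-cong (^q-zero E[]≈0) (-‿cong E[]≈0) ⟨
    E h [] ^ q - E h []     ∎
    where
    E[]≈0 : E h [] ≈ 0#
    E[]≈0 = E-zero h [] λ _ → K.refl
  bracket-E zero    (x ∷ p) = begin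
    (T - t) * (t * E 1 p + P ^ q)
      ≈⟨ solve 4 (λ T t e f → (T :- t) :* (t :* e :+ f)
                   := t :* ((T :- t) :* e) :+ (T :- t) :* f) refl T t _ _ ⟩
    t * ((T - t) * E 1 p) + (T - t) * P ^ q
      ≈⟨ +-congʳ (*-congˡ (bracket-E zero p)) ⟩
    t * (P ^ q - P) + (T - t) * P ^ q
      ≈⟨ solve 5 (λ T t c e f → t :* (f :- e) :+ (T :- t) :* f := (T :* f :+ c) :- (c :+ t :* e))
           refl T t (C x) P (P ^ q) ⟩
    (T * P ^ q + C x) - (C x + t * P)
      ≈⟨ +-congʳ (+-congʳ (trans (*-congʳ (^-congʳ t (ℕ.*-identityʳ q)))
                                 (sym (^-distrib-* t P q)))) ⟩
    ((t * P) ^ q + C x) - (C x + t * P)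
      ≈⟨ +-congʳ (trans (sym (^q-translate (t * P) x)) (^-congˡ q (+-comm _ _))) ⟩
    (C x + t * P) ^ q - (C x + t * P) ∎
    where
    T = t ^ (q ℕ.^ 1)
    P = ⟦ p ⟧
  bracket-E (suc h) (x ∷ p) = begin
    (T - t) * (t * E (suc (suc h)) p + F ^ q)
      ≈⟨ solve 4 (λ T t e f → (T :- t) :* (t :* e :+ f)
                   := t :* ((T :- t) :* e) :+ (T :- t) :* f) refl T t _ _ ⟩
    t * ((T - t) * E (suc (suc h)) p) + (T - t) * F ^ q
      ≈⟨ +-congʳ (*-congˡ (bracket-E (suc h) p)) ⟩
    t * (F ^ q - F) + (T - t) * F ^ q
      -- The detour through s = t^q: s F^q is (t F)^q, and T - s is the q-th power of the previous
      -- bracket.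
      ≈⟨ solve 5 (λ T t s e f → t :* (f :- e) :+ (T :- t) :* f
                   := s :* f :+ (T :- s) :* f :- t :* e) refl T t (t ^ q) F (F ^ q) ⟩
    t ^ q * F ^ q + (T - t ^ q) * F ^ q - t * F
      ≈⟨ +-congʳ (+-cong (sym (^-distrib-* t F q)) frobenius) ⟩
    (t * F) ^ q + ((G ^ q) ^ q - G ^ q) - t * F
      ≈⟨ solve 4 (λ u v w x → u :+ (v :- w) :- x := u :+ v :- (x :+ w)) refl _ _ _ _ ⟩
    (t * F) ^ q + (G ^ q) ^ q - (t * F + G ^ q)
      ≈⟨ +-congʳ (^q-+ (t * F) (G ^ q)) ⟨
    (t * F + G ^ q) ^ q - (t * F + G ^ q) ∎
    where
    T = t ^ (q ℕ.^ suc (suc h))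
    F = E (suc h) p
    G = E h p

    frobenius : (T - t ^ q) * F ^ q ≈ (G ^ q) ^ q - G ^ q
    frobenius = begin
      (T - t ^ q) * F ^ q                           ≈⟨ *-congʳ (+-congʳ (t^q^[1+h] (suc h))) ⟨
      ((t ^ (q ℕ.^ suc h)) ^ q - t ^ q) * F ^ q     ≈⟨ *-congʳ (^q-difference _ t) ⟨
      bracket (suc h) ^ q * F ^ q                   ≈⟨ ^-distrib-* _ F q ⟨
      (bracket (suc h) * F) ^ q                     ≈⟨ ^-congˡ q (bracket-E h p) ⟩
      (G ^ q - G) ^ q                               ≈⟨ ^q-difference (G ^ q) G ⟩
      (G ^ q) ^ q - G ^ q                           ∎

  D : ℕ → Carrier
  D zero    = 1#
  D (suc h) = bracket (suc h) * D h ^ q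

  private
    -- For i < q this is the constant a_i, extended to all natural numbers so that it can be a
    -- factor of `∏`.
    κ : ℕ → Carrier
    κ i = C (coeff (a i) 0)

    κ-toℕ : ∀ d → κ (toℕ d) ≈ C (to d)
    κ-toℕ d = C.⟦⟧-cong (a-constant d 0)

    subtract : List K.Carrier → List K.Carrier → List K.Carrier
    subtract p p′ = add p (map K.-_ p′)

    ⟦subtract⟧ : ∀ p p′ → ⟦ subtract p p′ ⟧ ≈ ⟦ p ⟧ - ⟦ p′ ⟧
    ⟦subtract⟧ p p′ = trans (⟦⟧.+-homo p _) (+-congˡ (⟦⟧.-‿homo p′))

    ⟦split⟧ : ∀ h d {j} → j < q ℕ.^ h →
      ⟦ a (toℕ d ℕ.* q ℕ.^ h ℕ.+ j) ⟧ ≈ ⟦ monomial (to d) h ⟧ + ⟦ a j ⟧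
    ⟦split⟧ h d {j} j< = trans
      (⟦⟧.⟦⟧-cong {a (toℕ d ℕ.* q ℕ.^ h ℕ.+ j)} {add (monomial (to d) h) (a j)} (a-split h d j<))
      (⟦⟧.+-homo (monomial (to d) h) (a j))

    -- Additivity is applied to p = (p - m) + m with m = x t^h, where E_h(m) = x.
    E-subtract : ∀ h p x → E h (subtract p (monomial x h)) ≈ E h p - C x
    E-subtract h p x = begin
      E h (subtract p m)                                 ≈⟨ solve 2 (λ u v → u := (u :+ v) :- v) refl _ (C x) ⟩
      (E h (subtract p m) + C x) - C x                   ≈⟨ +-congʳ (+-congˡ (E-monomial x h)) ⟨
      (E h (subtract p m) + E h m) - C x                 ≈⟨ +-congʳ (E-add h (subtract p m) m) ⟨
      E h (add (subtract p m) m) - C x                   ≈⟨ +-congʳ (E-cong h {add (subtract p m) m} {p} cancels) ⟩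
      E h p - C x                                        ∎
      where
      m = monomial x h

      open PolynomialProperties (FiniteField.commutativeRing 𝔽) using (coeff-add; coeff-neg)

      cancels : add (subtract p m) m ≋ p
      cancels n = K.trans (coeff-add (subtract p m) m n)
        (K.trans (K.+-congʳ (K.trans (coeff-add p _ n) (K.+-congˡ (coeff-neg m n))))
        (K.trans (K.+-assoc _ _ _) (K.trans (K.+-congˡ (K.-‿inverseˡ _)) (K.+-identityʳ _))))

    ∏-shifted : ∀ h d p n → n ≤ q ℕ.^ h →
      ∏ n (λ j → ⟦ p ⟧ - ⟦ a (toℕ d ℕ.* q ℕ.^ h ℕ.+ j) ⟧) ≈ falling n ⟦ subtract p (monomial (to d) h) ⟧
    ∏-shifted h d p n n≤ = ∏-cong n λ j j<n → begin
      ⟦ p ⟧ - ⟦ a (toℕ d ℕ.* q ℕ.^ h ℕ.+ j) ⟧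
        ≈⟨ +-congˡ (-‿cong (⟦split⟧ h d (ℕ.<-≤-trans j<n n≤))) ⟩
      ⟦ p ⟧ - (⟦ m ⟧ + ⟦ a j ⟧)
        ≈⟨ solve 3 (λ p m a → p :- (m :+ a) := p :- m :- a) refl _ _ _ ⟩
      ⟦ p ⟧ - ⟦ m ⟧ - ⟦ a j ⟧
        ≈⟨ +-congʳ (⟦subtract⟧ p m) ⟨
      ⟦ subtract p m ⟧ - ⟦ a j ⟧ ∎
      where m = monomial (to d) h

  -- The identity e_h = D_h E_h, by induction on h: e_{h+1}(x) splits into q blocks e_h(x - a_i t^h)
  -- = D_h (E_h(x) - a_i), and the product of the second factors over all constants is E_h^q - E_h =
  -- [h+1] E_{h+1}.
  falling-q^ : ∀ h p → falling (q ℕ.^ h) ⟦ p ⟧ ≈ D h * E h p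

  private
    ∏-blocks : ∀ h c p → c ≤ q →
      ∏ (c ℕ.* q ℕ.^ h) (λ j → ⟦ p ⟧ - ⟦ a j ⟧) ≈ D h ^ c * ∏ c λ i → E h p - κ i
    ∏-blocks h c p c≤q = begin
      ∏ (c ℕ.* N) (λ j → ⟦ p ⟧ - ⟦ a j ⟧)
        ≈⟨ ∏-* c N _ ⟩
      ∏ c (λ i → ∏ N λ j → ⟦ p ⟧ - ⟦ a (i ℕ.* N ℕ.+ j) ⟧)
        ≈⟨ ∏-cong c (λ i i<c → block i (ℕ.<-≤-trans i<c c≤q)) ⟩
      ∏ c (λ i → D h * (E h p - κ i))
        ≈⟨ ∏-scale c (D h) _ ⟩
      D h ^ c * ∏ c (λ i → E h p - κ i) ∎
      where
      N = q ℕ.^ h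

      blockFin : ∀ d → ∏ N (λ j → ⟦ p ⟧ - ⟦ a (toℕ d ℕ.* N ℕ.+ j) ⟧) ≈ D h * (E h p - κ (toℕ d))
      blockFin d = begin
        ∏ N (λ j → ⟦ p ⟧ - ⟦ a (toℕ d ℕ.* N ℕ.+ j) ⟧)    ≈⟨ ∏-shifted h d p N ℕ.≤-refl ⟩
        falling N ⟦ subtract p (monomial (to d) h) ⟧     ≈⟨ falling-q^ h (subtract p (monomial (to d) h)) ⟩
        D h * E h (subtract p (monomial (to d) h))       ≈⟨ *-congˡ (E-subtract h p (to d)) ⟩
        D h * (E h p - C (to d))                         ≈⟨ *-congˡ (+-congˡ (-‿cong (κ-toℕ d))) ⟨
        D h * (E h p - κ (toℕ d))                        ∎

      block : ∀ i → i < q → ∏ N (λ j → ⟦ p ⟧ - ⟦ a (i ℕ.* N ℕ.+ j) ⟧) ≈ D h * (E h p - κ i)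
      block i i<q = ≡.subst
        (λ i → ∏ N (λ j → ⟦ p ⟧ - ⟦ a (i ℕ.* N ℕ.+ j) ⟧) ≈ D h * (E h p - κ i))
        (Fin.toℕ-fromℕ< i<q) (blockFin (Fin.fromℕ< i<q))

  falling-q^ zero    p = begin
    (⟦ p ⟧ - ⟦ a 0 ⟧) * 1#  ≈⟨ *-comm _ _ ⟩
    1# * (⟦ p ⟧ - ⟦ a 0 ⟧)  ≈⟨ *-congˡ (+-congˡ (trans (-‿cong (⟦⟧.⟦⟧-cong {a 0} {[]} a-zero)) -0#≈0#)) ⟩
    1# * (⟦ p ⟧ + 0#)       ≈⟨ *-congˡ (+-identityʳ _) ⟩
    1# * ⟦ p ⟧              ∎
  falling-q^ (suc h) p = begin
    ∏ (q ℕ.* q ℕ.^ h) (λ j → ⟦ p ⟧ - ⟦ a j ⟧)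
      ≈⟨ ∏-blocks h q p ℕ.≤-refl ⟩
    D h ^ q * ∏ q (λ i → E h p - κ i)
      ≡⟨ ≡.cong (D h ^ q *_) (≡.sym (product-toℕ q (λ i → E h p - κ i))) ⟩
    D h ^ q * product {q} (λ i → E h p - κ (toℕ i))
      ≈⟨ *-congˡ (product-cong {q} λ i → +-congˡ (-‿cong (κ-toℕ i))) ⟩
    D h ^ q * product {q} (λ i → E h p - C (to i))
      ≈⟨ *-congˡ (x^q-x (E h p)) ⟨
    D h ^ q * (E h p ^ q - E h p)
      ≈⟨ *-congˡ (bracket-E h p) ⟨
    D h ^ q * (bracket (suc h) * E (suc h) p)
      ≈⟨ solve 3 (λ d b e → d :* (b :* e) := (b :* d) :* e) refl _ _ _ ⟩
    D (suc h) * E (suc h) p ∎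

  private
    ∏-invertible : ∀ n f → (∀ i → i < n → ∃ λ z → z * f i ≈ 1#) → ∃ λ z → z * ∏ n f ≈ 1#
    ∏-invertible zero    f inv = 1# , *-identityʳ 1#
    ∏-invertible (suc n) f inv
      with inv 0 (s≤s z≤n) | ∏-invertible n (f ∘ suc) (λ i i<n → inv (suc i) (s≤s i<n))
    ... | y , yf≈1 | z , zg≈1 = y * z ,
      trans (interchange y z _ _) (trans (*-cong yf≈1 zg≈1) (*-identityˡ 1#))

    -- The leading digit d gives d complete blocks. The incomplete block after them is an initial
    -- segment translated by a_d t^h.
    falling-split : ∀ h d {k} p → k < q ℕ.^ h →
      falling (toℕ d ℕ.* q ℕ.^ h ℕ.+ k) ⟦ p ⟧ ≈
        D h ^ toℕ d * ∏ (toℕ d) (λ i → E h p - κ i) * falling k ⟦ subtract p (monomial (to d) h) ⟧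
    falling-split h d {k} p k< = trans
      (∏-+ (toℕ d ℕ.* q ℕ.^ h) k _)
      (*-cong (∏-blocks h (toℕ d) p (ℕ.<⇒≤ (Fin.toℕ<n d))) (∏-shifted h d p k (ℕ.<⇒≤ k<)))

    -- At x = a_l, where l has leading digit d, the factors E_h(x) - a_i become a_d - a_i with i <
    -- d: nonzero constants, hence units. Up to a unit, the leading digit thus contributes just
    -- D_h^d to l!.
    κ-invertible : ∀ d → ∃ λ z → z * ∏ (toℕ d) (λ i → C (to d) - κ i) ≈ 1#
    κ-invertible d = ∏-invertible (toℕ d) _ invertible
      where
      Invertible : ℕ → Set _
      Invertible i = ∃ λ z → z * (C (to d) - κ i) ≈ 1#

      invertibleFin : ∀ i → toℕ i < toℕ d → Invertible (toℕ i)
      invertibleFin i i<d with C-invertible {to d} {to i} (ℕ.<⇒≢ i<d ∘ ≡.cong toℕ ∘ ≡.sym ∘ to-injective)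
      ... | z , e = z , trans (*-congˡ (+-congˡ (-‿cong (κ-toℕ i)))) e

      invertible : ∀ i → i < toℕ d → Invertible i
      invertible i i<d = ≡.subst Invertible eq
        (invertibleFin (Fin.fromℕ< i<q) (ℕ.≤-<-trans (ℕ.≤-reflexive eq) i<d))
        where
        i<q = ℕ.<-trans i<d (Fin.toℕ<n d)
        eq  = Fin.toℕ-fromℕ< i<q

    factorial∣-step : ∀ h d {k} → k < q ℕ.^ h →
      (∀ p → falling k ⟦ a k ⟧ ∣ falling k ⟦ p ⟧) →
      let l = toℕ d ℕ.* q ℕ.^ h ℕ.+ k in ∀ p → falling l ⟦ a l ⟧ ∣ falling l ⟦ p ⟧
    factorial∣-step h d {k} k< k!∣ p
      with k!∣ (subtract p (monomial (to d) h)) | κ-invertible d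
    -- The powers of D_h agree on both sides. `P` supplies the block factors at p, `v` removes those
    -- at a_l, and `w` is the quotient for the lower digits.
    ... | w , w*k!≈ | v , v*u≈1 = P * v * w , (begin
      P * v * w * falling l ⟦ a l ⟧
        ≈⟨ *-congˡ (falling-split h d (a l) k<) ⟩
      P * v * w * (D h ^ toℕ d * ∏ (toℕ d) (λ i → E h (a l) - κ i) * falling k ⟦ subtract (a l) m ⟧)
        ≈⟨ *-congˡ (*-cong (*-congˡ (∏-cong (toℕ d) λ i _ → +-congʳ E-aₗ)) (falling-cong k aₗ-m)) ⟩
      P * v * w * (D h ^ toℕ d * u * falling k ⟦ a k ⟧)
        ≈⟨ solve 6 (λ P v w d u f → P :* v :* w :* (d :* u :* f) := d :* P :* (w :* f) :* (v :* u))
             refl P v w (D h ^ toℕ d) u (falling k ⟦ a k ⟧) ⟩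
      D h ^ toℕ d * P * (w * falling k ⟦ a k ⟧) * (v * u)
        ≈⟨ *-cong (*-congˡ w*k!≈) v*u≈1 ⟩
      D h ^ toℕ d * P * falling k ⟦ subtract p m ⟧ * 1#
        ≈⟨ *-identityʳ _ ⟩
      D h ^ toℕ d * P * falling k ⟦ subtract p m ⟧
        ≈⟨ falling-split h d p k< ⟨
      falling l ⟦ p ⟧ ∎)
      where
      m = monomial (to d) h
      l = toℕ d ℕ.* q ℕ.^ h ℕ.+ k
      P = ∏ (toℕ d) λ i → E h p - κ i
      u = ∏ (toℕ d) λ i → C (to d) - κ i

      E-aₗ : E h (a l) ≈ C (to d)
      E-aₗ = begin
        E h (a l)              ≈⟨ E-cong h {a l} {add m (a k)} (a-split h d k<) ⟩
        E h (add m (a k))      ≈⟨ E-add h m (a k) ⟩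
        E h m + E h (a k)      ≈⟨ +-cong (E-monomial (to d) h) (E-below h (a k) (a-below h k<)) ⟩
        C (to d) + 0#          ≈⟨ +-identityʳ _ ⟩
        C (to d)               ∎

      aₗ-m : ⟦ subtract (a l) m ⟧ ≈ ⟦ a k ⟧
      aₗ-m = begin
        ⟦ subtract (a l) m ⟧      ≈⟨ ⟦subtract⟧ (a l) m ⟩
        ⟦ a l ⟧ - ⟦ m ⟧           ≈⟨ +-congʳ (⟦split⟧ h d k<) ⟩
        ⟦ m ⟧ + ⟦ a k ⟧ - ⟦ m ⟧   ≈⟨ solve 2 (λ m a → m :+ a :- m := a) refl _ _ ⟩
        ⟦ a k ⟧                   ∎

    factorial∣< : ∀ h k → k < q ℕ.^ h → ∀ p → falling k ⟦ a k ⟧ ∣ falling k ⟦ p ⟧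
    factorial∣< zero    zero    _        p = 1# , *-identityʳ 1#
    factorial∣< zero    (suc k) (s≤s ())
    factorial∣< (suc h) k       k<       p = ≡.subst
      (λ l → falling l ⟦ a l ⟧ ∣ falling l ⟦ p ⟧) split
      (factorial∣-step h d {k % N} (ℕ.m%n<n k N) (factorial∣< h (k % N) (ℕ.m%n<n k N)) p)
      where
      N = q ℕ.^ h
      instance _ = ℕ.m^n≢0 q h
      k/N<q = ℕ.m<n*o⇒m/o<n {k} {q} {N} k<
      d = Fin.fromℕ< k/N<q

      split : toℕ d ℕ.* N ℕ.+ k % N ≡ k
      split = ≡.trans (≡.cong (λ c → c ℕ.* N ℕ.+ k % N) (Fin.toℕ-fromℕ< k/N<q))
        (≡.trans (ℕ.+-comm (k / N ℕ.* N) (k % N)) (≡.sym (ℕ.m≡m%n+[m/n]*n k N)))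

    -- Lets k itself bound its number of digits in the induction of `factorial∣<`.
    n<q^n : ∀ n → n < q ℕ.^ n
    n<q^n zero    = ℕ.z<s
    n<q^n (suc n) = ℕ.≤-<-trans (n<q^n n)
      (ℕ.m<m*n (q ℕ.^ n) q {{ℕ.m^n≢0 q n}} 1<q ▹ ℕ.*-comm (q ℕ.^ n) q)
      where
      _▹_ : ∀ {k l m} → k < l → l ≡ m → k < m
      k<l ▹ ≡.refl = k<l

  factorial∣falling : ∀ k x → falling k ⟦ a k ⟧ ∣ falling k x
  factorial∣falling k x with generated x
  ... | p , x≈p with factorial∣< k k (n<q^n k) p
  ...   | w , e = w , trans e (falling-cong k (sym x≈p))

  module _ (b : ℕ → Carrier) (b≈⟦a⟧ : ∀ k → b k ≈ ⟦ a k ⟧) where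
    private module NewtonB = Newton R b

    -- In A, `a k` agrees with its own evaluation at t only up to the ring equality. This moves the
    -- divisibility to the sequence itself.
    factorial∣falling-resp : ∀ k x → NewtonB.falling k (b k) ∣ NewtonB.falling k x
    factorial∣falling-resp k x with factorial∣falling k x
    ... | w , e = w , (begin
      w * NewtonB.falling k (b k)    ≈⟨ *-congˡ (falling≈ (b k)) ⟩
      w * falling k (b k)            ≈⟨ *-congˡ (falling-cong k (b≈⟦a⟧ k)) ⟩
      w * falling k ⟦ a k ⟧          ≈⟨ e ⟩
      falling k x                    ≈⟨ falling≈ x ⟨
      NewtonB.falling k x            ∎)
      where
      falling≈ : ∀ y → NewtonB.falling k y ≈ falling k y
      falling≈ y = ∏-cong k λ j _ → +-congˡ (-‿cong (b≈⟦a⟧ j))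

-- Euclidean division, Bezout combinations and cofactors of gcds.

-- Below n x stands for deg x < n, with the zero element below every n.
module Euclidean {c ℓ ℓ′} (R : CommutativeRing c ℓ)
  (Below : ℕ → CommutativeRing.Carrier R → Set ℓ′) where
  open CommutativeRing R hiding (zero)
  open RawRingOps rawRing hiding (_-_)
  open import Algebra.Definitions.RawMagma *-rawMagma using (_,_)
  open import Algebra.Properties.CommutativeSemigroup.Divisibility *-commutativeSemigroup
    using (x∣ʳy⇒x∣ʳzy)
  open import Algebra.Properties.Monoid.Divisibility *-monoid using (∣ʳ-refl)
  open RingProperties ring using (x∙y⁻¹≈ε⇒x≈y; x≈y⇒x∙y⁻¹≈ε)
  open IntegerSolver R
  open SetoidReasoning setoid

  -- An abstract interface to polynomials of degree d: division with remainder, a zero remainder for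
  -- multiples, and cancellation. Gcds and normal forms are built on it without coefficients.
  record HasDegree (d : ℕ) (g : Carrier) : Set (c ⊔ ℓ ⊔ ℓ′) where
    field
      nonzero : g ≉ 0#
      below  : ∀ {n} → d < n → Below n g
      least  : ∀ {n} → Below n g → d < n
      divide : ∀ x → ∃₂ λ u r → x ≈ u * g + r × Below d r
      small  : ∀ {r} → Below d r → g ∣ r → r ≈ 0#
      cancel : ∀ {x} → x * g ≈ 0# → x ≈ 0#

  module Properties
    (zero⊎degree : ∀ g → g ≈ 0# ⊎ ∃ λ d → HasDegree d g)
    (Below-zero : ∀ x → Below 0 x → x ≈ 0#)
    (Below-mono : ∀ {m n} x → m ≤ n → Below m x → Below n x) where

    ∣-+ : ∀ {g x y} → g ∣ x → g ∣ y → g ∣ x + y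
    ∣-+ {g} (u , ug≈x) (v , vg≈y) = u + v , trans (distribʳ g u v) (+-cong ug≈x vg≈y)

    ∣-resp : ∀ {g x y} → x ≈ y → g ∣ x → g ∣ y
    ∣-resp x≈y (u , ug≈x) = u , trans ug≈x x≈y

    _∣0′ : ∀ g → g ∣ 0#
    g ∣0′ = 0# , zeroˡ g

    divides? : ∀ {d g} → HasDegree d g → ∀ x → Dec (g ∣ x)
    divides? {d} {g} deg-g x with HasDegree.divide deg-g x
    ... | u , r , x≈ug+r , r<d with zero⊎degree r
    ...   | inj₁ r≈0 = yes (u , sym (trans x≈ug+r (trans (+-congˡ r≈0) (+-identityʳ _))))
    ...   | inj₂ (e , deg-r) = no λ g∣x →
      HasDegree.nonzero deg-r (HasDegree.small deg-g r<d (remainder g∣x))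
      where
      remainder : g ∣ x → g ∣ r
      remainder (v , vg≈x) = v - u , (begin
        (v - u) * g          ≈⟨ solve 3 (λ v u g → (v :- u) :* g := v :* g :- u :* g) refl v u g ⟩
        v * g - u * g        ≈⟨ +-congʳ (trans vg≈x x≈ug+r) ⟩
        u * g + r - u * g    ≈⟨ solve 2 (λ y r → y :+ r :- y := r) refl (u * g) r ⟩
        r                    ∎)

    record Bezout (x y : Carrier) : Set (c ⊔ ℓ) where
      field
        d u v         : Carrier
        combination   : d ≈ u * x + v * y
        divides-left  : d ∣ x
        divides-right : d ∣ y

      isGCD : IsGCD d x y
      isGCD = record
        { divides-left = divides-left ; divides-right = divides-right
        ; greatest = λ e∣x e∣y → ∣-resp (sym combination) (∣-+ (x∣ʳy⇒x∣ʳzy u e∣x) (x∣ʳy⇒x∣ʳzy v e∣y)) }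

    private
      bezout-zero : ∀ {x y} → y ≈ 0# → Bezout x y
      bezout-zero {x} {y} y≈0 = record
        { d = x ; u = 1# ; v = 0#
        ; combination   = sym (trans (+-cong (*-identityˡ x) (zeroˡ y)) (+-identityʳ x))
        ; divides-left  = ∣ʳ-refl
        ; divides-right = ∣-resp (sym y≈0) (x ∣0′) }

      -- Euclid's algorithm, by recursion on a bound `n` for the degree of the second argument,
      -- which each remainder lowers.
      bezout-below : ∀ n x y → Below n y → Bezout x y
      bezout-below zero    x y y<n = bezout-zero (Below-zero y y<n)
      bezout-below (suc n) x y y<n with zero⊎degree y
      ... | inj₁ y≈0 = bezout-zero y≈0
      ... | inj₂ (e , deg-y) with HasDegree.divide deg-y x
      ...   | w , r , x≈wy+r , r<e = record
        -- Back substitution of r = x - w y into the combination of y and r.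
        { d = d ; u = v ; v = u - v * w
        ; combination = begin
            d                          ≈⟨ combination ⟩
            u * y + v * r              ≈⟨ solve 5 (λ u v w y r → u :* y :+ v :* r
                                            := v :* (w :* y :+ r) :+ (u :- v :* w) :* y) refl u v w y r ⟩
            v * (w * y + r) + (u - v * w) * y
                                       ≈⟨ +-congʳ (*-congˡ x≈wy+r) ⟨
            v * x + (u - v * w) * y    ∎
        ; divides-left  = ∣-resp (sym x≈wy+r) (∣-+ (x∣ʳy⇒x∣ʳzy w divides-left) divides-right)
        ; divides-right = divides-left
        }
        where open Bezout (bezout-below n y r (Below-mono r (ℕ.≤-pred (HasDegree.least deg-y y<n)) r<e))

    bezout : ∀ x y → Bezout x y
    bezout x y with zero⊎degree y
    ... | inj₁ y≈0         = bezout-zero y≈0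
    ... | inj₂ (e , deg-y) = bezout-below (suc e) x y (HasDegree.below deg-y ℕ.≤-refl)

    cancelʳ : ∀ {x y d} → d ≉ 0# → x * d ≈ y * d → x ≈ y
    cancelʳ {x} {y} {d} d≉0 xd≈yd with zero⊎degree d
    ... | inj₁ d≈0         = contradiction d≈0 d≉0
    ... | inj₂ (_ , deg-d) = x∙y⁻¹≈ε⇒x≈y x y (HasDegree.cancel deg-d (begin
      (x - y) * d    ≈⟨ solve 3 (λ x y d → (x :- y) :* d := x :* d :- y :* d) refl x y d ⟩
      x * d - y * d  ≈⟨ x≈y⇒x∙y⁻¹≈ε xd≈yd ⟩
      0#             ∎))

    module _ {g m d h : Carrier} (g≉0 : g ≉ 0#) (gcd : IsGCD d g m) (hd≈g : h * d ≈ g) where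
      open IsGCD gcd

      gcd≉0 : d ≉ 0#
      gcd≉0 d≈0 = g≉0 (trans (sym hd≈g) (trans (*-congˡ d≈0) (zeroʳ h)))

      cofactor≉0 : h ≉ 0#
      cofactor≉0 h≈0 = g≉0 (trans (sym hd≈g) (trans (*-congʳ h≈0) (zeroˡ d)))

      -- The Bezout gcd e of g and m divides the given d, so d is itself a combination of g and m.
      -- Times x, both of its terms are multiples of g = h d, and d cancels.
      cofactor-∣ : ∀ {x} → g ∣ x * m → h ∣ x
      cofactor-∣ {x} (w , wg≈xm) with bezout g m
      ... | record { d = e ; u = u ; v = v ; combination = e≈ug+vm
                   ; divides-left = e∣g ; divides-right = e∣m }
        with greatest e∣g e∣m
      ...   | s , se≈d = s * u * x + s * v * w , cancelʳ gcd≉0 (begin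
        (s * u * x + s * v * w) * h * d        ≈⟨ *-assoc _ h d ⟩
        (s * u * x + s * v * w) * (h * d)      ≈⟨ *-congˡ hd≈g ⟩
        (s * u * x + s * v * w) * g
          ≈⟨ solve 6 (λ s u x v w g → (s :* u :* x :+ s :* v :* w) :* g
                       := s :* u :* x :* g :+ s :* v :* (w :* g))
               refl s u x v w g ⟩
        s * u * x * g + s * v * (w * g)        ≈⟨ +-congˡ (*-congˡ wg≈xm) ⟩
        s * u * x * g + s * v * (x * m)
          ≈⟨ solve 6 (λ s u x v m g → s :* u :* x :* g :+ s :* v :* (x :* m)
                       := x :* (s :* (u :* g :+ v :* m)))
               refl s u x v m g ⟩
        x * (s * (u * g + v * m))              ≈⟨ *-congˡ (*-congˡ e≈ug+vm) ⟨
        x * (s * e)                            ≈⟨ *-congˡ se≈d ⟩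
        x * d                                  ∎)

      -- Since d divides d′, the equality h d = h′ d′ makes h a multiple of h′. One direction is
      -- enough to compare degrees.
      cofactor-unique : ∀ {d′ h′} → IsGCD d′ g m → h′ * d′ ≈ g → h′ ∣ h
      cofactor-unique {d′} {h′} gcd′ h′d′≈g
        with IsGCD.greatest gcd′ divides-left divides-right
      ... | s , sd≈d′ = s , cancelʳ gcd≉0 (begin
        s * h′ * d    ≈⟨ solve 3 (λ s h d → s :* h :* d := h :* (s :* d)) refl s h′ d ⟩
        h′ * (s * d)  ≈⟨ *-congˡ sd≈d′ ⟩
        h′ * d′       ≈⟨ h′d′≈g ⟩
        g             ≈⟨ hd≈g ⟨
        h * d         ∎)

    ∣⇒degree≤ : ∀ {d e g h} → HasDegree d g → HasDegree e h → g ∣ h → d ≤ e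
    ∣⇒degree≤ deg-g deg-h g∣h = ℕ.≮⇒≥ λ e<d → HasDegree.nonzero deg-h
      (HasDegree.small deg-g (HasDegree.below deg-h e<d) g∣h)

-- Polynomials over the field as an instance of the interface.

module PolynomialDivision {c ℓ₁ ℓ₂} (𝔽 : FiniteField c ℓ₁ ℓ₂) where
  open FiniteField 𝔽 using (_≈?_)
  open FiniteFieldProperties 𝔽
  open Digits 𝔽 using (Below; _≋_)
  open OverFiniteField 𝔽 using (deg; _deg<_)
  open CommutativeRing (FiniteField.commutativeRing 𝔽) hiding (zero)
  open Polynomial rawRing hiding (polynomialRing)
  open PolynomialProperties (FiniteField.commutativeRing 𝔽)
  open IntegerSolver (FiniteField.commutativeRing 𝔽)
  open RingProperties ring
  open SetoidReasoning setoid
  private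
    module A = CommutativeRing polynomialCommutativeRing

  open Euclidean polynomialCommutativeRing Below

  private
    all⇒≋[] : ∀ {p} → ListAll.All (_≈ 0#) p → p ≋ []
    all⇒≋[] ListAll.[]         n       = refl
    all⇒≋[] (e ListAll.∷ es)   zero    = e
    all⇒≋[] (e ListAll.∷ es)   (suc n) = all⇒≋[] es n

    ≋[]⇒all : ∀ p → p ≋ [] → ListAll.All (_≈ 0#) p
    ≋[]⇒all []      e = ListAll.[]
    ≋[]⇒all (x ∷ p) e = e 0 ListAll.∷ ≋[]⇒all p (e ∘ suc)

  deg-zero : ∀ p → p ≋ [] → deg p ≡ 0
  deg-zero []      _   = ≡.refl
  deg-zero (x ∷ p) e with ListAll.all? (_≈? 0#) p
  ... | yes _  = ≡.refl
  ... | no p≉0 = contradiction (≋[]⇒all p (e ∘ suc)) p≉0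

  deg-below : ∀ p → Below (suc (deg p)) p
  deg-below []      n _ = refl
  deg-below (x ∷ p) n n> with ListAll.all? (_≈? 0#) p
  deg-below (x ∷ p) (suc n) _        | yes p≈0 = all⇒≋[] p≈0 n
  deg-below (x ∷ p) (suc n) (s≤s n>) | no _    = deg-below p n n>

  leading : ∀ p → p ≋ [] ⊎ coeff p (deg p) ≉ 0#
  leading []      = inj₁ λ _ → refl
  leading (x ∷ p) with ListAll.all? (_≈? 0#) p
  leading (x ∷ p) | yes p≈0 with x ≈? 0#
  ... | yes x≈0 = inj₁ λ { zero → x≈0 ; (suc n) → all⇒≋[] p≈0 n }
  ... | no  x≉0 = inj₂ x≉0
  leading (x ∷ p) | no p≉0 with leading p
  ... | inj₁ p≈0 = contradiction (≋[]⇒all p p≈0) p≉0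
  ... | inj₂ l≉0 = inj₂ l≉0

  below⇒deg< : ∀ {n} p → Below n p → p deg< n
  below⇒deg< p p<n with leading p
  ... | inj₁ p≈0 = inj₁ p≈0
  ... | inj₂ l≉0 = inj₂ (ℕ.≰⇒> λ n≤ → l≉0 (p<n _ n≤))

  deg<⇒below : ∀ {n} p → p deg< n → Below n p
  deg<⇒below p (inj₁ p≈0) i _   = p≈0 i
  deg<⇒below p (inj₂ d<n) i n≤i = deg-below p i (ℕ.<-≤-trans d<n n≤i)

  coeff-mul-leading : ∀ {m n} p p′ → Below (suc m) p → Below (suc n) p′ →
    coeff (mul p p′) (m ℕ.+ n) ≈ coeff p m * coeff p′ n
  coeff-mul-leading []      p′ p< p′< = sym (zeroˡ _)
  coeff-mul-leading {zero} {n} (x ∷ p) p′ p< p′< = begin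
    coeff (mul (x ∷ p) p′) n                ≈⟨ coeff-mul-∷ x p p′ n ⟩
    x * coeff p′ n + coeff (0# ∷ mul p p′) n  ≈⟨ +-congˡ (vanish n) ⟩
    x * coeff p′ n + 0#                     ≈⟨ +-identityʳ _ ⟩
    x * coeff p′ n                          ∎
    where
    vanish : (0# ∷ mul p p′) ≋ []
    vanish zero    = refl
    vanish (suc n) = A.*-cong {p} {[]} {p′} {p′} (λ i → p< (suc i) (s≤s z≤n)) (λ _ → refl) n
  coeff-mul-leading {suc m} {n} (x ∷ p) p′ p< p′< = begin
    coeff (mul (x ∷ p) p′) (suc (m ℕ.+ n))
      ≈⟨ coeff-mul-∷ x p p′ (suc (m ℕ.+ n)) ⟩
    x * coeff p′ (suc (m ℕ.+ n)) + coeff (mul p p′) (m ℕ.+ n)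
      ≈⟨ +-cong (trans (*-congˡ (p′< _ (s≤s (ℕ.m≤n+m n m)))) (zeroʳ x))
                (coeff-mul-leading p p′ (λ i m< → p< (suc i) (s≤s m<)) p′<) ⟩
    0# + coeff p m * coeff p′ n
      ≈⟨ +-identityˡ _ ⟩
    coeff p m * coeff p′ n ∎

  module _ {d : ℕ} {g : List Carrier} (g-below : Below (suc d) g) (lead≉0 : coeff g d ≉ 0#) where

    private
      lead⁻¹ : Carrier
      lead⁻¹ = proj₁ (inverse lead≉0)

    -- From p = u g + r follows x + t p = (t u) g + s with s = x + t r of degree at most d.
    -- Subtracting b g, with b chosen to cancel the coefficient of s at d, brings the remainder
    -- below d.
    divide : ∀ p → ∃₂ λ u r → p ≋ add (mul u g) r × Below d r
    divide []      = [] , [] , (λ _ → refl) , (λ _ _ → refl)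
    divide (x ∷ p) with divide p
    ... | u , r , p≋ug+r , r<d = b ∷ u , r′ , equal , below
      where
      s = x ∷ r
      b = coeff s d * lead⁻¹
      r′ = add s (map -_ (map (b *_) g))

      coeff-r′ : ∀ n → coeff r′ n ≈ coeff s n - b * coeff g n
      coeff-r′ n = trans (coeff-add s (map -_ (map (b *_) g)) n)
        (+-congˡ (trans (coeff-neg (map (b *_) g) n) (-‿cong (coeff-scale b g n))))

      x∷p≋ : ∀ n → coeff (x ∷ p) n ≈ coeff (0# ∷ mul u g) n + coeff s n
      x∷p≋ zero    = sym (+-identityˡ x)
      x∷p≋ (suc n) = trans (p≋ug+r n) (coeff-add (mul u g) r n)

      equal : x ∷ p ≋ add (mul (b ∷ u) g) r′
      equal n = begin
        coeff (x ∷ p) n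
          ≈⟨ x∷p≋ n ⟩
        coeff (0# ∷ mul u g) n + coeff s n
          ≈⟨ solve 3 (λ y s z → y :+ s := (z :+ y) :+ (s :- z)) refl _ _ (b * coeff g n) ⟩
        (b * coeff g n + coeff (0# ∷ mul u g) n) + (coeff s n - b * coeff g n)
          ≈⟨ +-cong (coeff-mul-∷ b u g n) (coeff-r′ n) ⟨
        coeff (mul (b ∷ u) g) n + coeff r′ n
          ≈⟨ coeff-add (mul (b ∷ u) g) r′ n ⟨
        coeff (add (mul (b ∷ u) g) r′) n ∎

      below : Below d r′
      below n d≤n with ℕ.m≤n⇒m<n∨m≡n d≤n
      ... | inj₂ ≡.refl = begin
        coeff r′ n                                      ≈⟨ coeff-r′ n ⟩
        coeff s n - coeff s n * lead⁻¹ * coeff g n      ≈⟨ +-congˡ (-‿cong (*-assoc _ _ _)) ⟩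
        coeff s n - coeff s n * (lead⁻¹ * coeff g n)    ≈⟨ +-congˡ (-‿cong (*-congˡ (proj₂ (inverse lead≉0)))) ⟩
        coeff s n - coeff s n * 1#                      ≈⟨ +-congˡ (-‿cong (*-identityʳ _)) ⟩
        coeff s n - coeff s n                           ≈⟨ -‿inverseʳ _ ⟩
        0#                                              ∎
      below (suc n) _ | inj₁ (s≤s d≤n) = begin
        coeff r′ (suc n)                                ≈⟨ coeff-r′ (suc n) ⟩
        coeff r n - b * coeff g (suc n)
          ≈⟨ +-cong (r<d n d≤n) (-‿cong (trans (*-congˡ (g-below (suc n) (s≤s d≤n))) (zeroʳ b))) ⟩
        0# - 0#                                         ≈⟨ -‿inverseʳ 0# ⟩
        0#                                              ∎

    -- A nonzero u has a leading coefficient, and its product with that of g is a nonzero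
    -- coefficient of u g in degree deg u + d.
    mul-small : ∀ u → Below d (mul u g) → u ≋ []
    mul-small u ug<d with leading u
    ... | inj₁ u≈0 = u≈0
    ... | inj₂ l≉0 = contradiction (*-cancel-0 l≉0 (trans
      (sym (coeff-mul-leading u g (deg-below u) g-below)) (ug<d _ (ℕ.m≤n+m d (deg u))))) lead≉0

    hasDegree-leading : HasDegree d g
    hasDegree-leading = record
      { nonzero = λ g≈0 → lead≉0 (g≈0 d)
      ; below   = λ d<n i n≤i → g-below i (ℕ.<-≤-trans d<n n≤i)
      ; least   = λ g<n → ℕ.≰⇒> λ n≤d → lead≉0 (g<n d n≤d)
      ; divide  = divide
      ; small   = λ { {r} r<d (u , ug≈r) n → trans (sym (ug≈r n))
                    (A.*-cong {u} {[]} {g} {g}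
                      (mul-small u λ i d≤i → trans (ug≈r i) (r<d i d≤i)) (λ _ → refl) n) }
      ; cancel  = λ {u} ug≈0 → mul-small u λ i _ → ug≈0 i
      }
      where open import Algebra.Definitions.RawMagma A.*-rawMagma using (_,_)

  hasDegree : ∀ {g} → ¬ g ≋ [] → HasDegree (deg g) g
  hasDegree {g} g≉0 with leading g
  ... | inj₁ g≈0 = contradiction g≈0 g≉0
  ... | inj₂ l≉0 = hasDegree-leading (deg-below g) l≉0

  zero⊎degree : ∀ g → g ≋ [] ⊎ ∃ λ d → HasDegree d g
  zero⊎degree g with leading g
  ... | inj₁ g≈0 = inj₁ g≈0
  ... | inj₂ l≉0 = inj₂ (deg g , hasDegree-leading (deg-below g) l≉0)

-- Reduction to the Newton basis modulo g.

module Representation {c ℓ} (R : CommutativeRing c ℓ)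
  (a : ℕ → CommutativeRing.Carrier R) (g : CommutativeRing.Carrier R) where

  open CommutativeRing R using (Carrier; rawRing)
  open Multivariate rawRing
  open Quotient R g using (quotientRing)
  open CommutativeRing quotientRing hiding (zero; Carrier; rawRing)
  open Newton quotientRing a
  open BigOperators quotientRing using (∑; boxSum; ∑-cong; boxSum-cong; boxSum-scale; boxSum-+)
  open SetoidReasoning setoid

  private
    -- The coefficients of G + x F: those of F are shifted in the first index as by `shift`, and
    -- those of G, which is free of the first variable, are added at index 0.
    stack : ∀ {r} → (Vec ℕ r → Carrier) → (Vec ℕ (suc r) → Carrier) → Vec ℕ (suc r) → Carrier
    stack c c′ (zero  ∷ ks) = a 0 * c′ (zero ∷ ks) + c ks
    stack c c′ (suc k ∷ ks) = a (suc k) * c′ (suc k ∷ ks) + c′ (k ∷ ks)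

  -- Horner's rule in the Newton basis.
  represent : ∀ {r} (ms : Vec ℕ r) → All (0 <_) ms → (F : RawRing.Carrier (multivariateRing rawRing r)) →
    ∃ λ c → ∀ xs → Pointwise (λ m x → falling m x ≈ 0#) ms xs →
      eval F xs ≈ boxSum ms λ ks → c ks * fallings ks xs
  represent []           []       F        = (λ _ → F) , λ { [] [] → sym (*-identityʳ F) }
  represent (m ∷ ms)     (_ ∷ _)  []       = (λ _ → 0#) , λ { (x ∷ xs) _ →
    sym (trans (boxSum-scale (m ∷ ms) 0# (λ ks → fallings ks (x ∷ xs))) (zeroˡ _)) }
  represent (suc m ∷ ms) (p ∷ ps) (G ∷ F)
    with represent ms ps G | represent (suc m ∷ ms) (p ∷ ps) F
  ... | c , represents-G | c′ , represents-F = stack c c′ , represents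
    where
    represents : ∀ xs → Pointwise (λ m x → falling m x ≈ 0#) (suc m ∷ ms) xs →
      eval (G ∷ F) xs ≈ boxSum (suc m ∷ ms) λ ks → stack c c′ ks * fallings ks xs
    represents (x ∷ xs) (x-vanishes ∷ xs-vanish) = begin
      eval G xs + x * eval F (x ∷ xs)
        ≈⟨ +-cong (represents-G xs xs-vanish)
             (*-congˡ (represents-F (x ∷ xs) (x-vanishes ∷ xs-vanish))) ⟩
      e₀ + x * boxSum (suc m ∷ ms) (λ ks → c′ ks * fallings ks (x ∷ xs))
        ≈⟨ +-congˡ (*-congˡ (∑-cong (suc m) λ k _ → boxSum-factor ms (falling k x) xs λ ks → c′ (k ∷ ks))) ⟩
      e₀ + x * ∑ (suc m) (λ k → e k * falling k x)
        ≈⟨ +-congˡ (*-newton m e x) ⟩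
      e₀ + (∑ (suc m) (λ k → shift e k * falling k x) + e m * falling (suc m) x)
        -- Multiplication by x would enlarge the box by one, but the extra term carries (x)ₘ₊₁, zero
        -- modulo g at the residues.
        ≈⟨ +-congˡ (trans (+-congˡ (trans (*-congˡ x-vanishes) (zeroʳ _))) (+-identityʳ _)) ⟩
      e₀ + (shift e 0 * 1# + ∑ m (λ k → shift e (suc k) * falling (suc k) x))
        ≈⟨ +-assoc _ _ _ ⟨
      e₀ + shift e 0 * 1# + ∑ m (λ k → shift e (suc k) * falling (suc k) x)
        ≈⟨ +-cong (trans (+-cong (sym (*-identityʳ e₀)) refl)
                         (trans (sym (distribʳ 1# e₀ (shift e 0))) (*-congʳ (trans (+-comm _ _) (sym stack-zero)))))
                  (∑-cong m λ k _ → *-congʳ (sym (stack-suc k))) ⟩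
      ∑ (suc m) (λ k → boxSum ms (λ ks → stack c c′ (k ∷ ks) * fallings ks xs) * falling k x)
        ≈⟨ ∑-cong (suc m) (λ k _ → boxSum-factor ms (falling k x) xs λ ks → stack c c′ (k ∷ ks)) ⟨
      boxSum (suc m ∷ ms) (λ ks → stack c c′ ks * fallings ks (x ∷ xs)) ∎
      where
      e₀ = boxSum ms λ ks → c ks * fallings ks xs

      e : ℕ → Carrier
      e k = boxSum ms λ ks → c′ (k ∷ ks) * fallings ks xs

      linear : ∀ y (h h′ : Vec ℕ _ → Carrier) →
        boxSum ms (λ ks → (y * h ks + h′ ks) * fallings ks xs) ≈
          y * boxSum ms (λ ks → h ks * fallings ks xs) + boxSum ms (λ ks → h′ ks * fallings ks xs)
      linear y h h′ = begin
        boxSum ms (λ ks → (y * h ks + h′ ks) * fallings ks xs)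
          ≈⟨ boxSum-cong {ms = ms} (λ ks _ → trans (distribʳ _ _ _) (+-congʳ (*-assoc y (h ks) _))) ⟩
        boxSum ms (λ ks → y * (h ks * fallings ks xs) + h′ ks * fallings ks xs)
          ≈⟨ boxSum-+ ms _ _ ⟩
        boxSum ms (λ ks → y * (h ks * fallings ks xs)) + boxSum ms (λ ks → h′ ks * fallings ks xs)
          ≈⟨ +-congʳ (boxSum-scale ms y _) ⟩
        y * boxSum ms (λ ks → h ks * fallings ks xs) + boxSum ms (λ ks → h′ ks * fallings ks xs) ∎

      stack-zero : boxSum ms (λ ks → stack c c′ (zero ∷ ks) * fallings ks xs) ≈ shift e 0 + e₀
      stack-zero = linear (a 0) (λ ks → c′ (zero ∷ ks)) c

      stack-suc : ∀ k → boxSum ms (λ ks → stack c c′ (suc k ∷ ks) * fallings ks xs) ≈ shift e (suc k)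
      stack-suc k = linear (a (suc k)) (λ ks → c′ (suc k ∷ ks)) (λ ks → c′ (k ∷ ks))

leastWitness : ∀ {p} {P : Pred ℕ p} → Decidable P → ∀ n → P n →
               ∃ λ m → P m × ∀ {k} → P k → m ≤ k
leastWitness {P = P} P? = <-rec _ step
  where
  step : ∀ n → (∀ {m} → m < n → P m → ∃ λ l → P l × ∀ {k} → P k → l ≤ k) →
         P n → ∃ λ l → P l × ∀ {k} → P k → l ≤ k
  step n rec pn with ℕ.anyUpTo? P? n
  ... | yes (m , m<n , pm) = rec m<n pm
  ... | no  none           = n , pn , λ {k} pk → ℕ.≮⇒≥ λ k<n → none (k , k<n , pk)

-- Existence and uniqueness of normal forms.

module NormalForms {c ℓ ℓ′} (R : CommutativeRing c ℓ)
  (Below : ℕ → CommutativeRing.Carrier R → Set ℓ′) (a : ℕ → CommutativeRing.Carrier R) where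

  open CommutativeRing R hiding (zero)
  open Multivariate rawRing
  open MultivariateProperties R
  open RawRingOps rawRing using (_∣_; IsGCD)
  open import Algebra.Definitions.RawMagma *-rawMagma using (_,_)
  open import Algebra.Properties.CommutativeSemigroup.Divisibility *-commutativeSemigroup
    using (∣ʳ-trans; ∙-cong-∣)
  open import Algebra.Properties.Monoid.Divisibility *-monoid using (∣ʳ-refl)
  open Newton R a using (falling; fallings; factorials)
  open BigOperators R using (boxSum; boxSum-cong)
  open IntegerSolver R
  open Euclidean R Below using (HasDegree)

  module Modulo
    (zero⊎degree : ∀ g → g ≈ 0# ⊎ ∃ λ d → HasDegree d g)
    (Below-zero : ∀ x → Below 0 x → x ≈ 0#)
    (Below-mono : ∀ {m n} x → m ≤ n → Below m x → Below n x)
    (Below-difference : ∀ {n} x y → Below n x → Below n y → Below n (x - y))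
    (bound : ℕ → ℕ)
    (a-surjective : ∀ d x → Below d x → ∃ λ k → k < bound d × x ≈ a k)
    (factorial∣falling : ∀ k x → falling k (a k) ∣ falling k x)
    {g : Carrier} {γ : ℕ} (deg-g : HasDegree γ g) where

    open Euclidean.Properties R Below zero⊎degree Below-zero Below-mono
    open Quotient R g

    -- The bound is imposed for every degree of the cofactor `h`. It is never vacuous: h d = g is
    -- nonzero, so `h` has a degree.
    Reduced : Carrier → Carrier → Set _
    Reduced m b = ∃₂ λ d h → IsGCD d g m × h * d ≈ g × (∀ {e} → HasDegree e h → Below e b)

    private
      module Q where
        open CommutativeRing quotientRing public
        open BigOperators quotientRing public
        open Newton quotientRing a public
      open SetoidReasoning Q.setoid

    g≉0 : g ≉ 0#
    g≉0 = HasDegree.nonzero deg-g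

    lambda : ∃ λ l → (0 < l × g ∣ falling l (a l)) ×
                     (∀ {k} → 0 < k × g ∣ falling k (a k) → l ≤ k)
    lambda = leastWitness (λ k → (0 ℕ.<? k) ×-dec divides? deg-g (falling k (a k))) N divisible
      where
      -- a_N is congruent modulo g to its remainder, which is some a_k with k < N. Hence a factor of
      -- N! is divisible by g.
      N = bound γ

      divisible : 0 < N × g ∣ falling N (a N)
      divisible with HasDegree.divide deg-g (a N)
      ... | u , r , aN≈ug+r , r<γ with a-surjective γ r r<γ
      ...   | k , k<N , r≈aₖ = ℕ.≤-<-trans z≤n k<N , ∼0⇒∣ (Q.∏-zero _ k<N (∣⇒∼0 (u ,
        trans (solve 2 (λ y r → y := y :+ r :- r) refl (u * g) r)
          (+-cong (sym aN≈ug+r) (-‿cong r≈aₖ)))))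

    -- Each argument of the minimum has its own reason. If it is `l`, then g divides l!, which
    -- divides (x)ₗ. If it is `bound d`, then x is one of the a_k with k < `bound d`, and a factor
    -- is zero.
    falling-vanishes : ∀ {d l x} → g ∣ falling l (a l) → Below d x → g ∣ falling (bound d ⊓ l) x
    falling-vanishes {d} {l} {x} g∣l! x<d with ℕ.⊓-sel (bound d) l
    ... | inj₂ eq rewrite eq = ∣ʳ-trans g∣l! (factorial∣falling l x)
    ... | inj₁ eq rewrite eq with a-surjective d x x<d
    ...   | k , k< , x≈aₖ = ∼0⇒∣ (Q.falling-zero k< (≈⇒∼ x≈aₖ))

    factorials∣fallings : ∀ {r} (ks : Vec ℕ r) xs → factorials ks ∣ fallings ks xs
    factorials∣fallings []       []       = ∣ʳ-refl
    factorials∣fallings (k ∷ ks) (x ∷ xs) =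
      ∙-cong-∣ (factorial∣falling k x) (factorials∣fallings ks xs)

    -- Write g = h d and let b be the remainder of c modulo h. Then (c - b) y is a multiple of h y,
    -- and d divides m, hence y, so it is a multiple of g.
    reduce : ∀ m c → ∃ λ b → Reduced m b × (∀ {y} → m ∣ y → c * y ∼ b * y)
    reduce m c with bezout g m
    ... | bz with Bezout.divides-left bz
    ...   | h , hd≈g with zero⊎degree h
    ...     | inj₁ h≈0 = contradiction h≈0 (cofactor≉0 g≉0 (Bezout.isGCD bz) hd≈g)
    ...     | inj₂ (e , deg-h) with HasDegree.divide deg-h c
    ...       | u , b , c≈uh+b , b<e =
      b , (Bezout.d bz , h , Bezout.isGCD bz , hd≈g ,
            -- Any two degrees of h agree, since h divides itself.
            λ deg′ → Below-mono b (∣⇒degree≤ deg-h deg′ ∣ʳ-refl) b<e) , agree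
      where
      agree : ∀ {y} → m ∣ y → c * y ∼ b * y
      agree {y} m∣y with ∣ʳ-trans (Bezout.divides-right bz) m∣y
      ... | w , wd≈y = u * w , trans (*-congˡ (sym hd≈g)) (trans
        (solve 5 (λ u w h d b → u :* w :* (h :* d) := (u :* h :+ b) :* (w :* d) :- b :* (w :* d))
          refl u w h (Bezout.d bz) b)
        (+-cong (*-cong (sym c≈uh+b) wd≈y) (-‿cong (*-congˡ wd≈y))))

    module _ {r : ℕ} (ms : Vec ℕ r) where
      private
        module M where
          open CommutativeRing (multivariateCommutativeRing r) hiding (rawRing) public
          open RawRingOps (multivariateRing rawRing r) using (sumOver) public

      newtonSum : (Vec ℕ r → Carrier) → M.Carrier
      newtonSum b = M.sumOver (multiIndices ms) λ ks → const {r} (b ks) M.* newtonMonomial a ks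

      newtonSum-cong : ∀ {b b′} → (∀ ks → Pointwise _<_ ks ms → b ks ≈ b′ ks) →
        newtonSum b M.≈ newtonSum b′
      newtonSum-cong {b} {b′} b≈b′ = M.trans (sumOver-multiIndicesᴹ ms _)
        (M.trans (boxSum-congᴹ {ms = ms} (λ ks ks<ms → M.*-congʳ (const-cong r (b≈b′ ks ks<ms))))
          (M.sym (sumOver-multiIndicesᴹ ms _)))
        where open BigOperators (multivariateCommutativeRing r) using () renaming
                (sumOver-multiIndices to sumOver-multiIndicesᴹ; boxSum-cong to boxSum-congᴹ)

      representative : All (0 <_) ms → (F : M.Carrier) → ∃ λ b →
        (∀ ks → Reduced (factorials ks) (b ks)) ×
        (∀ xs → Pointwise (λ m x → g ∣ falling m x) ms xs → eval {r} (newtonSum b) xs ∼ eval {r} F xs)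
      representative ms>0 F with Representation.represent R a g ms ms>0 F
      ... | c , represents = b , (λ ks → proj₁ (proj₂ (reduced ks))) , agrees
        where
        reduced : ∀ ks → _
        reduced ks = reduce (factorials ks) (c ks)

        b : Vec ℕ r → Carrier
        b ks = proj₁ (reduced ks)

        agrees : ∀ xs → Pointwise (λ m x → g ∣ falling m x) ms xs → eval {r} (newtonSum b) xs ∼ eval {r} F xs
        agrees xs vanish = begin
          eval (newtonSum b) xs                         ≈⟨ ≈⇒∼ (eval-newtonSum a ms b xs) ⟩
          boxSum ms (λ ks → b ks * fallings ks xs)
            ≈⟨ Q.boxSum-cong {ms = ms} (λ ks _ →
                 proj₂ (proj₂ (reduced ks)) (factorials∣fallings ks xs)) ⟨
          boxSum ms (λ ks → c ks * fallings ks xs)      ≈⟨ represents xs (Pointwise.map ∣⇒∼0 vanish) ⟨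
          eval F xs                                     ∎

      newtonSum-injective : ∀ {b b′} →
        (∀ ks → Pointwise _<_ ks ms → Reduced (factorials ks) (b ks)) →
        (∀ ks → Pointwise _<_ ks ms → Reduced (factorials ks) (b′ ks)) →
        (∀ ks → Pointwise _<_ ks ms →
          eval (newtonSum b) (Vec.map a ks) ∼ eval (newtonSum b′) (Vec.map a ks)) →
        newtonSum b M.≈ newtonSum b′
      newtonSum-injective {b} {b′} reduced reduced′ agree = newtonSum-cong equal
        where
        δ : Vec ℕ r → Carrier
        δ ks = b ks - b′ ks

        vanish : ∀ ks → Pointwise _<_ ks ms →
          boxSum ms (λ js → δ js * fallings js (Vec.map a ks)) ∼ 0#
        vanish ks ks<ms = begin
          S δ                   ≈⟨ ≈⇒∼ (solve 2 (λ x y → x := x :+ y :- y) refl (S δ) (S b′)) ⟩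
          S δ + S b′ - S b′     ≈⟨ Q.+-congʳ (Q.boxSum-+ ms _ _) ⟨
          boxSum ms (λ js → δ js * fallings js xs + b′ js * fallings js xs) - S b′
                                ≈⟨ ≈⇒∼ (+-congʳ (boxSum-cong {ms = ms} λ js _ →
                                     solve 3 (λ x y f → (x :- y) :* f :+ y :* f := x :* f)
                                       refl (b js) (b′ js) (fallings js xs))) ⟩
          S b - S b′            ≈⟨ Q.+-cong S-eval (Q.-‿cong S-eval′) ⟩
          eval (newtonSum b) xs - eval (newtonSum b′) xs
                                ≈⟨ Q.+-congʳ (agree ks ks<ms) ⟩
          eval (newtonSum b′) xs - eval (newtonSum b′) xs
                                ≈⟨ Q.-‿inverseʳ _ ⟩
          0#                    ∎
          where
          xs = Vec.map a ks

          S : (Vec ℕ r → Carrier) → Carrier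
          S b = boxSum ms λ js → b js * fallings js xs

          S-eval : S b ∼ eval (newtonSum b) xs
          S-eval = ≈⇒∼ (sym (eval-newtonSum a ms b xs))
          S-eval′ : S b′ ∼ eval (newtonSum b′) xs
          S-eval′ = ≈⇒∼ (sym (eval-newtonSum a ms b′ xs))

        factorial∣falling∼ : ∀ k x → RawRingOps._∣_ Q.rawRing (falling k (a k)) (falling k x)
        factorial∣falling∼ k x with factorial∣falling k x
        ... | w , e = record { quotient = w ; equality = ≈⇒∼ e }

        equal : ∀ ks → Pointwise _<_ ks ms → b ks ≈ b′ ks
        equal ks ks<ms with reduced ks ks<ms | reduced′ ks ks<ms
        ... | d , h , gcd , hd≈g , b< | d′ , h′ , gcd′ , h′d′≈g , b′< with zero⊎degree h | zero⊎degree h′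
        ...   | inj₁ h≈0 | _ = contradiction h≈0 (cofactor≉0 g≉0 gcd hd≈g)
        ...   | _ | inj₁ h′≈0 = contradiction h′≈0 (cofactor≉0 g≉0 gcd′ h′d′≈g)
        ...   | inj₂ (e , deg-h) | inj₂ (e′ , deg-h′) = x∙y⁻¹≈ε⇒x≈y (b ks) (b′ ks)
          (HasDegree.small deg-h
            (Below-difference (b ks) (b′ ks) (b< deg-h)
              -- The two coefficients are bounded through different cofactors; h′ divides h, so the
              -- bound for b′ carries over to deg h.
              (Below-mono (b′ ks) (∣⇒degree≤ deg-h′ deg-h (cofactor-unique g≉0 gcd hd≈g gcd′ h′d′≈g)) (b′< deg-h′)))
            (cofactor-∣ g≉0 gcd hd≈g
              (∼0⇒∣ (Q.Triangular.triangular factorial∣falling∼ ms δ vanish ks ks<ms))))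
          where open RingProperties ring using (x∙y⁻¹≈ε⇒x≈y)

-- The case of polynomials over the finite field.

module _ {c ℓ₁ ℓ₂} (𝔽 : FiniteField c ℓ₁ ℓ₂) where
  open OverFiniteField 𝔽
  open Digits 𝔽
  open PolynomialDivision 𝔽
  private
    module K = CommutativeRing (FiniteField.commutativeRing 𝔽)
    open PolynomialProperties (FiniteField.commutativeRing 𝔽)
    open Polynomial K.rawRing using (coeff; mul)
    Aᴿ = polynomialCommutativeRing
    module Aᴿ = CommutativeRing Aᴿ
    open RawRingOps A using (_∣_; IsGCD)

  constant : K.Carrier → ∣A∣
  constant x = x ∷ []

  constant-isRingHomomorphism : IsRingHomomorphism K.rawRing A constant
  constant-isRingHomomorphism = record
    { isSemiringHomomorphism = record
      { isNearSemiringHomomorphism = record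
        { +-isMonoidHomomorphism = record
          { isMagmaHomomorphism = record
            { isRelHomomorphism = record { cong = λ { x≈y zero → x≈y ; x≈y (suc n) → K.refl } }
            ; homo = λ x y n → K.refl
            }
          ; ε-homo = λ { zero → K.refl ; (suc n) → K.refl }
          }
        ; *-homo = λ { x y zero → K.sym (K.+-identityʳ _) ; x y (suc n) → K.refl }
        }
      ; 1#-homo = λ n → K.refl
      }
    ; -‿homo = λ x n → K.refl
    }

  private
    t : ∣A∣
    t = K.0# ∷ K.1# ∷ []

    open PolynomialEvaluation (FiniteField.commutativeRing 𝔽) Aᴿ constant-isRingHomomorphism t using (evaluate)

  -- Supplies the generation of A by t over the constants that Carlitz's theorem asks for.
  evaluate-t : ∀ p → p ≋ evaluate p
  evaluate-t []      n = K.refl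
  evaluate-t (x ∷ p) n = K.trans (shifted n) (K.sym (coeff-add (constant x) (mul t (evaluate p)) n))
    where
    shifted : ∀ n → coeff (x ∷ p) n K.≈ coeff (constant x) n K.+ coeff (mul t (evaluate p)) n
    t* : ∀ p n → coeff (mul t p) n K.≈ coeff (K.0# ∷ p) n
    t* p n = K.trans (coeff-mul-∷ K.0# (K.1# ∷ []) p n)
      (K.trans (K.+-cong (K.zeroˡ _) (tail n)) (K.+-identityˡ _))
      where
      tail : ∀ n → coeff (K.0# ∷ mul (K.1# ∷ []) p) n K.≈ coeff (K.0# ∷ p) n
      tail zero    = K.refl
      tail (suc n) = Aᴿ.*-identityˡ p n
    shifted zero    = K.sym (K.trans (K.+-congˡ (t* (evaluate p) 0)) (K.+-identityʳ x))
    shifted (suc n) = K.trans (evaluate-t p n)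
      (K.sym (K.trans (K.+-congˡ (t* (evaluate p) (suc n))) (K.+-identityˡ _)))

  private
    module Factorials where
      open Newton Aᴿ a public using (falling; factorials)
      open BigOperators Aᴿ using (product-toℕ)

      factorial≡ : ∀ k → factorial k ≡ falling k (a k)
      factorial≡ k = product-toℕ k λ j → a k Aᴿ.- a j

      multiFactorial≡ : ∀ {r} (ks : Vec ℕ r) → multiFactorial ks ≡ factorials ks
      multiFactorial≡ []       = ≡.refl
      multiFactorial≡ (k ∷ ks) = ≡.cong₂ Aᴿ._*_ (factorial≡ k) (multiFactorial≡ ks)
    open Factorials

    factorial∣falling : ∀ k x → falling k (a k) ∣ falling k x
    factorial∣falling = Carlitz.factorial∣falling-resp 𝔽 Aᴿ constant-isRingHomomorphism t
      (λ p → p , evaluate-t p) a (λ k → evaluate-t (a k))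

    Below-zero : ∀ p → Below 0 p → p ≋ []
    Below-zero p p< n = p< n z≤n

    Below-mono : ∀ {m n} p → m ≤ n → Below m p → Below n p
    Below-mono p m≤n p< i n≤i = p< i (ℕ.≤-trans m≤n n≤i)

    Below-difference : ∀ {n} p p′ → Below n p → Below n p′ → Below n (p Aᴿ.- p′)
    Below-difference p p′ p< p′< i n≤i = K.trans (coeff-add p (map K.-_ p′) i)
      (K.trans (K.+-cong (p< i n≤i) (K.trans (coeff-neg p′ i) (K.-‿cong (p′< i n≤i))))
               (K.-‿inverseʳ K.0#))

    open FiniteField 𝔽 using (q)

  nonConstant≉0 : ∀ {p} → NonConstant p → ¬ p ≋ []
  nonConstant≉0 {p} 0<deg p≈0 = ℕ.<⇒≢ 0<deg (≡.sym (deg-zero p p≈0))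

  module MainTheorem {g : ∣A∣} (g≉0 : ¬ g ≋ []) where

    private
      module Theory = NormalForms.Modulo Aᴿ Below a zero⊎degree Below-zero Below-mono
        Below-difference (q ℕ.^_) a-surjective factorial∣falling (hasDegree {g} g≉0)
      module Division = Euclidean.Properties Aᴿ Below zero⊎degree Below-zero Below-mono
    open Quotient Aᴿ g using (≈⇒∼; quotientRing)
    private module Q = CommutativeRing quotientRing

    reduced⇒bound : ∀ {r} (ks : Vec ℕ r) {b} → Theory.Reduced (factorials ks) b → CoefficientBound g ks b
    reduced⇒bound ks {b} (d , h , gcd , hd≈g , b<h) = d , h ,
      ≡.subst (IsGCD d g) (≡.sym (multiFactorial≡ ks)) gcd , hd≈g ,
      below⇒deg< b (b<h (hasDegree {h} (Division.cofactor≉0 {g} {factorials ks} {d} {h} g≉0 gcd hd≈g)))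

    bound⇒reduced : ∀ {r} (ks : Vec ℕ r) {b} → CoefficientBound g ks b → Theory.Reduced (factorials ks) b
    bound⇒reduced ks {b} (d , h , gcd , hd≈g , b<h) = d , h , gcd′ , hd≈g , λ {e} deg-h i e≤i →
      deg<⇒below b b<h i (ℕ.≤-trans
        (Division.∣⇒degree≤ {g = h} {h} (hasDegree {h} h≉0) deg-h h∣h) e≤i)
      where
      gcd′ : IsGCD d g (factorials ks)
      gcd′ = ≡.subst (IsGCD d g) (multiFactorial≡ ks) gcd

      h≉0 : ¬ h ≋ []
      h≉0 = Division.cofactor≉0 {g} {factorials ks} {d} {h} g≉0 gcd′ hd≈g

      h∣h : h ∣ h
      h∣h = record { quotient = Aᴿ.1# ; equality = Aᴿ.*-identityˡ h }

    lambda : ∃ λ l → IsLambda g l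
    lambda = fromLeast Theory.lambda
      where
      fromLeast : (∃ λ l → (0 < l × g ∣ falling l (a l)) × (∀ {k} → 0 < k × g ∣ falling k (a k) → l ≤ k)) →
                  ∃ λ l → IsLambda g l
      fromLeast (l , (0<l , g∣l!) , least) = l , record
        { positive = 0<l
        ; divides  = ≡.subst (g ∣_) (≡.sym (factorial≡ l)) g∣l!
        ; least    = λ {k} 0<k g∣k! → least (0<k , ≡.subst (g ∣_) (factorial≡ k) g∣k!)
        }

    isLambda-unique : ∀ {l m} → IsLambda g l → IsLambda g m → l ≡ m
    isLambda-unique isL isM = ℕ.≤-antisym
      (IsLambda.least isL (IsLambda.positive isM) (IsLambda.divides isM))
      (IsLambda.least isM (IsLambda.positive isL) (IsLambda.divides isL))

    module _ {lam : ℕ} (isLambda : IsLambda g lam) where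

      μ-positive : ∀ {r} (fs : Vec ∣A∣ r) → All (0 <_) (Vec.map (μ {r} lam) fs)
      μ-positive []       = []
      μ-positive (f ∷ fs) =
        ℕ.⊓-glb (ℕ.m^n>0 q (deg f)) (IsLambda.positive {g} isLambda) ∷ μ-positive fs

      falling-vanishes : ∀ {r} {bs fs : Vec ∣A∣ r} → Pointwise (λ b f → b deg< deg f) bs fs →
        Pointwise (λ m x → g ∣ falling m x) (Vec.map (μ {r} lam) fs) bs
      falling-vanishes []                  = []
      falling-vanishes {bs = b ∷ _} (b<f ∷ bs<fs) =
        Theory.falling-vanishes {l = lam}
          (≡.subst (g ∣_) (factorial≡ lam) (IsLambda.divides isLambda)) (deg<⇒below b b<f)
          ∷ falling-vanishes bs<fs

      -- μ is at most q^(deg f), so the points at which uniqueness evaluates are residues, and both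
      -- polynomials are known there modulo g.
      a-residues : ∀ {r} {ks : Vec ℕ r} {fs : Vec ∣A∣ r} → Pointwise _<_ ks (Vec.map (μ {r} lam) fs) →
        Pointwise (λ b f → b deg< deg f) (Vec.map a ks) fs
      a-residues {fs = []}             []            = []
      a-residues {ks = k ∷ _} {f ∷ fs} (k<m ∷ ks<ms) =
        below⇒deg< (a k) (a-below (deg f) (ℕ.<-≤-trans k<m (ℕ.m⊓n≤m _ lam))) ∷ a-residues ks<ms

      module _ {r : ℕ} (fs : Vec ∣A∣ r) (φ : Residues fs → ∣A∣) where

        private
          ms : Vec ℕ r
          ms = Vec.map (μ {r} lam) fs
          module M = CommutativeRing (MultivariateProperties.multivariateCommutativeRing Aᴿ r)

        open Multivariate A using (eval)
        open MultivariateProperties Aᴿ using (eval-isRingHomomorphism)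

        exists : (F : MPoly r) → Represents {r} fs g F φ →
          ∃ λ (F′ : MPoly r) → NormalForm {r} fs g F′ × Represents {r} fs g F′ φ
        exists F represents = normalize (Theory.representative ms (μ-positive fs) F)
          where
          normalize : (∃ λ b → (∀ ks → Theory.Reduced (factorials ks) (b ks)) ×
              (∀ xs → Pointwise (λ m x → g ∣ falling m x) ms xs →
                eval {r} (Theory.newtonSum ms b) xs Q.≈ eval {r} F xs)) →
            ∃ λ (F′ : MPoly r) → NormalForm {r} fs g F′ × Represents {r} fs g F′ φ
          normalize (b , reduced , agrees) = Theory.newtonSum ms b , record
            { lam      = lam
            ; isLambda = isLambda
            ; b        = b
            ; bounded  = λ ks _ → reduced⇒bound ks {b ks} (reduced ks)
            ; expand   = M.refl
            } , λ bs → Q.trans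
              {eval {r} (Theory.newtonSum ms b) (proj₁ bs)} {eval {r} F (proj₁ bs)} {φ bs}
              (agrees (proj₁ bs) (falling-vanishes (proj₂ bs))) (represents bs)

        unique : ∀ {F F′ : MPoly r} → NormalForm {r} fs g F → Represents {r} fs g F φ →
                 NormalForm {r} fs g F′ → Represents {r} fs g F′ φ → F M.≈ F′
        unique {F} {F′} nf rep nf′ rep′ = go
          (isLambda-unique (NormalForm.isLambda nf) isLambda)
          (isLambda-unique (NormalForm.isLambda nf′) isLambda)
          (NormalForm.bounded nf) (NormalForm.bounded nf′) (NormalForm.expand nf) (NormalForm.expand nf′)
          where
          -- Each normal form brings its own value of λ(g). With these as variables, their
          -- uniqueness identifies the two boxes.
          go : ∀ {l l′ b b′} → l ≡ lam → l′ ≡ lam →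
            (∀ ks → Pointwise _<_ ks (Vec.map (μ {r} l) fs) → CoefficientBound g ks (b ks)) →
            (∀ ks → Pointwise _<_ ks (Vec.map (μ {r} l′) fs) → CoefficientBound g ks (b′ ks)) →
            F M.≈ Theory.newtonSum (Vec.map (μ {r} l) fs) b →
            F′ M.≈ Theory.newtonSum (Vec.map (μ {r} l′) fs) b′ →
            F M.≈ F′
          go {b = b} {b′} ≡.refl ≡.refl bounded bounded′ expand expand′ =
            M.trans expand (M.trans
              (Theory.newtonSum-injective ms {b} {b′}
                (λ ks ks<ms → bound⇒reduced ks {b ks} (bounded ks ks<ms))
                (λ ks ks<ms → bound⇒reduced ks {b′ ks} (bounded′ ks ks<ms))
                λ ks ks<ms → agree (Vec.map a ks , a-residues ks<ms))
              (M.sym expand′))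
            where
            agree : ∀ bs → eval {r} (Theory.newtonSum ms b) (proj₁ bs)
                           Q.≈ eval {r} (Theory.newtonSum ms b′) (proj₁ bs)
            agree bs@(xs , _) = begin
              eval {r} (Theory.newtonSum ms b) xs   ≈⟨ eval-cong F _ expand ⟨
              eval {r} F xs                         ≈⟨ rep bs ⟩
              φ bs                                  ≈⟨ rep′ bs ⟨
              eval {r} F′ xs                        ≈⟨ eval-cong F′ _ expand′ ⟩
              eval {r} (Theory.newtonSum ms b′) xs  ∎
              where
              eval-cong : ∀ G H → G M.≈ H → eval {r} G xs Q.≈ eval {r} H xs
              eval-cong G H G≈H = ≈⇒∼ {eval {r} G xs} {eval {r} H xs}
                (IsRingHomomorphism.⟦⟧-cong (eval-isRingHomomorphism xs) {G} {H} G≈H)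

              open SetoidReasoning Q.setoid

mainTheorem7 : ∀ {c ℓ₁ ℓ₂} (𝔽 : FiniteField c ℓ₁ ℓ₂) → let open OverFiniteField 𝔽 in
    ∀ {r : ℕ} (fs : Vec ∣A∣ r) (g : ∣A∣) →
    All NonConstant fs → NonConstant g →
    (f : Residues fs → ∣A∣) → IsPolynomialFunction fs g f →
    ∃! (_≈ᴹ_ {r}) (λ F → NormalForm fs g F × Represents fs g F f)
mainTheorem7 𝔽 {r} fs g _ g-nonConstant f (F , represents) =
  existsUnique (exists (proj₂ lambda) fs f F represents)
  where
  open OverFiniteField 𝔽
  open MainTheorem 𝔽 {g} (nonConstant≉0 𝔽 {g} g-nonConstant)

  existsUnique : (∃ λ (F′ : MPoly r) → NormalForm {r} fs g F′ × Represents {r} fs g F′ f) →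
    ∃! (_≈ᴹ_ {r}) (λ F → NormalForm fs g F × Represents fs g F f)
  existsUnique (F′ , nf , rep) =
    F′ , (nf , rep) , λ { (nf′ , rep′) → unique (proj₂ lambda) fs f nf rep nf′ rep′ }
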